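{- (1) Consider the eight points in $\mathbb{R}^3$: $s=(0,0,0)$, $e=(1,0,0)$, $w=(0,1,0)$, $n=(1,1,0)$, $v_1=(-1,0,1)$, $v_2=(1,1,1)$, $u_1=(0,1,-1)$, $u_2=(2,0,-1)$. These eight points are the vertices of a polytope $P$ whose only integer points are precisely its eight vertices, and: (a) $P$ has a unique maximal dissection; it has $12$ tetrahedra, all of which are unimodular, i.e. have volume $1/6$; (b) the maximal triangulations of $P$ (of which there are several) have $11$ tetrahedra. (2) For the $3$-polytope with vertices $u_1=(1,0,0)$, $w=(1,0,1)$, $v_1=(-1,0,0)$, $s=(-1,0,-1)$, $v_2=(0,1,1)$, $n=(1,1,1)$, $u_2=(0,1,-1)$, $e=(-1,1,-1)$: there is a unique minimal dissection and it has size $6$; the minimal triangulations (of which there are several) have size $7$; the maximal triangulations (of which there are several) have size $9$; and there is a unique maximal dissection and it has size $10$.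
   Context: A dissection of a convex $3$-polytope $P$ is a set of tetrahedra whose vertices are among the vertices of $P$, such that no two of them have an interior point in common and their union is $P$. A dissection is a triangulation if any two of its tetrahedra intersect in a common face (possibly empty). The size of a dissection is its number of tetrahedra; maximal (minimal) means of maximum (minimum) size. "Several" means more than one. Integer points are points of $\mathbb{Z}^3$. -}

module Defs where

open import Algebra.Bundles using (CommutativeRing)
import Algebra.Properties.Semiring.Mult as Mult
import Algebra.Properties.Semiring.Sum as Sum
open import Data.Fin.Base using (Fin; zero; suc)
open import Data.Fin.Subset using (Subset; ⁅_⁆; _∪_; _⊆_; ∣_∣; ⊤)
  renaming (_∈_ to _∈ₛ_; _∉_ to _∉ₛ_)
open import Data.Integer.Base as ℤ using (ℤ; +_; -[1+_])
open import Data.List.Base using (List; length)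
open import Data.List.Membership.Propositional using (_∈_)
open import Data.List.Relation.Binary.BagAndSetEquality using (_∼[_]_; set)
open import Data.List.Relation.Unary.All using (All)
open import Data.List.Relation.Unary.Any using (Any)
open import Data.List.Relation.Unary.Unique.Propositional using (Unique)
open import Data.Nat.Base as ℕ using (ℕ)
open import Data.Product.Base using (∃; _×_)
open import Data.Rational.Base as ℚ using (ℚ)
open import Data.Vec.Base using (Vec; []; _∷_; lookup)
open import Data.Vec.Functional using (Vector)
open import Function.Bundles using (_⇔_)
open import Level using (_⊔_) renaming (suc to lsuc)
open import Relation.Binary.Core using (Rel)
import Relation.Binary.Construct.StrictToNonStrict as NonStrict
open import Relation.Binary.PropositionalEquality.Core using (_≡_; _≢_)
open import Relation.Binary.Structures using (IsStrictTotalOrder)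
open import Relation.Nullary.Negation.Core using (¬_)

-- The order is trichotomous (hence decidable), as it is for ℝ classically.
-- The geometry below is developed over such a field K, with K³ for ℝ³.

record OrderedField c ℓ₁ ℓ₂ : Set (lsuc (c ⊔ ℓ₁ ⊔ ℓ₂)) where
  infix 4 _<_
  field
    commutativeRing : CommutativeRing c ℓ₁
  open CommutativeRing commutativeRing public
  field
    _<_                : Rel Carrier ℓ₂
    isStrictTotalOrder : IsStrictTotalOrder _≈_ _<_
    0#<1#              : 0# < 1#
    +-monoʳ-<          : ∀ z {x y} → x < y → z + x < z + y
    *-positive         : ∀ {x y} → 0# < x → 0# < y → 0# < x * y
    inverse            : ∀ x → x ≉ 0# → ∃ λ y → x * y ≈ 1#

  infix 4 _≤_
  _≤_ : Rel Carrier (ℓ₁ ⊔ ℓ₂)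
  _≤_ = NonStrict._≤_ _≈_ _<_

LatticePoint : Set
LatticePoint = Vec ℤ 3

LatticePoints : ℕ → Set
LatticePoints n = Vec LatticePoint n

-- A polytope is given by the family of its vertices, indexed by Fin n.  A
-- simplex spanned by some of them is represented by the set of their indices,
-- and a set of simplices by a list, always required to be duplicate-free and
-- compared up to set equality (so that its size is its length).

Simplices : ℕ → Set
Simplices n = List (Subset n)

module Geometry {c ℓ₁ ℓ₂} (K : OrderedField c ℓ₁ ℓ₂) where
  open OrderedField K
  open Mult semiring using () renaming (_×_ to _·_)
  open Sum semiring using (sum)

  Point : Set c
  Point = Vector Carrier 3

  infix 4 _≋_
  _≋_ : Point → Point → Set ℓ₁
  x ≋ y = ∀ k → x k ≈ y k

  ⟨_,_⟩ : Point → Point → Carrier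
  ⟨ a , x ⟩ = sum (λ k → a k * x k)

  fromℤ : ℤ → Carrier
  fromℤ (+ n)    = n · 1#
  fromℤ -[1+ n ] = - (ℕ.suc n · 1#)

  embed : LatticePoint → Point
  embed z k = fromℤ (lookup z k)

  embedAll : ∀ {n} → LatticePoints n → Fin n → Point
  embedAll p i = embed (lookup p i)

  Interior : ∀ {ℓ} → (Point → Set ℓ) → Point → Set (c ⊔ ℓ₂ ⊔ ℓ)
  Interior S x = ∃ λ ε → 0# < ε ×
    (∀ y → (∀ k → x k - ε < y k × y k < x k + ε) → S y)

  -- Vertices are the 0-dimensional faces: the points at which some linear
  -- functional attains its maximum uniquely.
  IsVertex : ∀ {ℓ} → (Point → Set ℓ) → Point → Set (c ⊔ ℓ₁ ⊔ ℓ₂ ⊔ ℓ)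
  IsVertex S x = S x × ∃ λ (a : Point) →
    ∀ y → S y → ¬ (y ≋ x) → ⟨ a , y ⟩ < ⟨ a , x ⟩

  module _ {n : ℕ} (V : Fin n → Point) where

    conv : Subset n → Point → Set (c ⊔ ℓ₁ ⊔ ℓ₂)
    conv T x = ∃ λ (w : Vector Carrier n) →
      (∀ i → 0# ≤ w i) ×
      (∀ i → i ∉ₛ T → w i ≈ 0#) ×
      sum w ≈ 1# ×
      (∀ k → sum (λ i → w i * V i k) ≈ x k)

    polytope : Point → Set (c ⊔ ℓ₁ ⊔ ℓ₂)
    polytope = conv ⊤

    AreTheVertices : Set (c ⊔ ℓ₁ ⊔ ℓ₂)
    AreTheVertices =
      (∀ i j → V i ≋ V j → i ≡ j) ×
      (∀ x → IsVertex polytope x ⇔ ∃ λ i → x ≋ V i)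

    AffinelyIndependent : Subset n → Set (c ⊔ ℓ₁)
    AffinelyIndependent T = ∀ (m : Vector Carrier n) →
      (∀ i → i ∉ₛ T → m i ≈ 0#) →
      sum m ≈ 0# →
      (∀ k → sum (λ i → m i * V i k) ≈ 0#) →
      ∀ i → m i ≈ 0#

    IsTetrahedron : Subset n → Set (c ⊔ ℓ₁)
    IsTetrahedron T = ∣ T ∣ ≡ 4 × AffinelyIndependent T

    IsDissection : Simplices n → Set (c ⊔ ℓ₁ ⊔ ℓ₂)
    IsDissection D =
      Unique D ×
      All IsTetrahedron D ×
      (∀ {T T′} → T ∈ D → T′ ∈ D → T ≢ T′ →
        ¬ (∃ λ x → Interior (conv T) x × Interior (conv T′) x)) ×
      (∀ x → polytope x ⇔ Any (λ T → conv T x) D)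

    -- The faces of a simplex, including the empty one, are the convex hulls
    -- of the subsets of its vertex set.
    MeetInCommonFace : Subset n → Subset n → Set (c ⊔ ℓ₁ ⊔ ℓ₂)
    MeetInCommonFace T T′ = ∃ λ F → F ⊆ T × F ⊆ T′ ×
      (∀ x → (conv T x × conv T′ x) ⇔ conv F x)

    IsTriangulation : Simplices n → Set (c ⊔ ℓ₁ ⊔ ℓ₂)
    IsTriangulation D = IsDissection D ×
      (∀ {T T′} → T ∈ D → T′ ∈ D → MeetInCommonFace T T′)

module _ {n ℓ} (Q : Simplices n → Set ℓ) where

  Maximal : Simplices n → Set ℓ
  Maximal D = Q D × (∀ D′ → Q D′ → length D′ ℕ.≤ length D)

  Minimal : Simplices n → Set ℓ
  Minimal D = Q D × (∀ D′ → Q D′ → length D ℕ.≤ length D′)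

  TheUnique : Simplices n → Set ℓ
  TheUnique D = Q D × (∀ D′ → Q D′ → D′ ∼[ set ] D)

  Several : Set ℓ
  Several = ∃ λ D → ∃ λ D′ → Q D × Q D′ × ¬ (D ∼[ set ] D′)

det₃ : LatticePoint → LatticePoint → LatticePoint → ℤ
det₃ (a₁ ∷ a₂ ∷ a₃ ∷ []) (b₁ ∷ b₂ ∷ b₃ ∷ []) (c₁ ∷ c₂ ∷ c₃ ∷ []) =
  a₁ * (b₂ * c₃ - b₃ * c₂) - a₂ * (b₁ * c₃ - b₃ * c₁) + a₃ * (b₁ * c₂ - b₂ * c₁)
  where open import Data.Integer.Base using (_+_; _-_; _*_)

infixl 6 _⊖_
_⊖_ : LatticePoint → LatticePoint → LatticePoint
(a₁ ∷ a₂ ∷ a₃ ∷ []) ⊖ (b₁ ∷ b₂ ∷ b₃ ∷ []) =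
  (a₁ ℤ.- b₁) ∷ (a₂ ℤ.- b₂) ∷ (a₃ ℤ.- b₃) ∷ []

volume : (a b c d : LatticePoint) → ℚ
volume a b c d = (+ ℤ.∣ det₃ (b ⊖ a) (c ⊖ a) (d ⊖ a) ∣) ℚ./ 6

-- The volume does not depend on the order in which the vertices are listed.
IsUnimodular : ∀ {n} → LatticePoints n → Subset n → Set
IsUnimodular p T = ∃ λ a → ∃ λ b → ∃ λ c → ∃ λ d →
  T ≡ ⁅ a ⁆ ∪ ⁅ b ⁆ ∪ ⁅ c ⁆ ∪ ⁅ d ⁆ ×
  volume (lookup p a) (lookup p b) (lookup p c) (lookup p d) ≡ (+ 1) ℚ./ 6

point : ℤ → ℤ → ℤ → LatticePoint
point x y z = x ∷ y ∷ z ∷ []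

private
  -1ℤ 0ℤ 1ℤ 2ℤ : ℤ
  -1ℤ = -[1+ 0 ]
  0ℤ  = + 0
  1ℤ  = + 1
  2ℤ  = + 2

-- In the order s, e, w, n, v₁, v₂, u₁, u₂.
points₁ : LatticePoints 8
points₁ =
  point 0ℤ  0ℤ 0ℤ  ∷
  point 1ℤ  0ℤ 0ℤ  ∷
  point 0ℤ  1ℤ 0ℤ  ∷
  point 1ℤ  1ℤ 0ℤ  ∷
  point -1ℤ 0ℤ 1ℤ  ∷
  point 1ℤ  1ℤ 1ℤ  ∷
  point 0ℤ  1ℤ -1ℤ ∷
  point 2ℤ  0ℤ -1ℤ ∷ []

-- In the order u₁, w, v₁, s, v₂, n, u₂, e.
points₂ : LatticePoints 8
points₂ =
  point 1ℤ  0ℤ 0ℤ  ∷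
  point 1ℤ  0ℤ 1ℤ  ∷
  point -1ℤ 0ℤ 0ℤ  ∷
  point -1ℤ 0ℤ -1ℤ ∷
  point 0ℤ  1ℤ 1ℤ  ∷
  point 1ℤ  1ℤ 1ℤ  ∷
  point 0ℤ  1ℤ -1ℤ ∷
  point -1ℤ 1ℤ -1ℤ ∷ []

{-# OPTIONS --safe #-}
module Submission where

open import Defs
open import Algebra.Bundles using (Semiring)
import Algebra.Properties.CommutativeSemigroup as CommutativeSemigroupProperties
import Algebra.Properties.Ring as RingProperties
import Algebra.Properties.Semiring.Mult as Mult
import Algebra.Properties.Semiring.Sum as Sum
import Algebra.Solver.Ring as Solver
open import Algebra.Solver.Ring.AlmostCommutativeRing using (fromCommutativeRing; _-Raw-AlmostCommutative⟶_)
open import Data.Bool.Base using (Bool; true; false; if_then_else_)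
import Data.Bool.Properties as Bool
open import Data.Fin.Base using (Fin; zero; suc)
open import Data.Fin.Patterns
import Data.Fin.Properties as Fin
open import Data.Fin.Subset using (Subset; inside; outside; _∈_; _∉_; _⊆_; _∩_; _∪_; ⊤; ⁅_⁆; ∣_∣) renaming (_-_ to _∖_)
open import Data.Fin.Subset.Properties using (_∈?_; ∈⊤; p∩q⊆p; p∩q⊆q; x∈p∩q⁺; x∈⁅x⁆; x∈⁅y⁆⇒x≡y)
open import Data.Integer.Base as ℤ using (ℤ; +_; -[1+_]; +[1+_]; 0ℤ; 1ℤ)
import Data.Integer.Properties as ℤ
open import Data.Integer.Tactic.RingSolver using (solve-∀)
open import Data.List.Base as List using (List; []; _∷_; length; filter; foldr; concatMap)
import Data.List.Membership.DecPropositional as DecMembership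
open import Data.List.Membership.Propositional using (find; lose) renaming (_∈_ to _∈ₗ_; _∉_ to _∉ₗ_)
open import Data.List.Membership.Propositional.Properties using (∈-map⁺; ∈-upTo⁺)
open import Data.List.Relation.Binary.BagAndSetEquality using (_∼[_]_; set)
open import Data.List.Relation.Unary.All as All using (All; []; _∷_)
open import Data.List.Relation.Unary.AllPairs as AllPairs using (AllPairs; []; _∷_)
open import Data.List.Relation.Unary.Any as Any using (Any; here; there)
import Data.List.Relation.Unary.Unique.DecPropositional as DecUnique
open import Data.List.Relation.Unary.Unique.Propositional using (Unique)
open import Data.Maybe.Base as Maybe using ()
open import Data.Nat.Base as ℕ using (ℕ)
import Data.Nat.Properties as ℕ
open import Data.Product.Base using (∃; _×_; _,_; proj₁; proj₂; uncurry)
import Data.Rational.Base as ℚ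
import Data.Rational.Properties as ℚ
open import Data.Sum.Base using (_⊎_; inj₁; inj₂; [_,_]′)
open import Data.Vec.Base using (Vec; []; _∷_; lookup; map; replicate; tabulate; toList; zipWith)
open import Data.Vec.Functional using (Vector; tail)
import Data.Vec.Properties as Vec
open import Function.Base using (_∘_; const)
open import Function.Bundles using (_⇔_; mk⇔; Equivalence)
open import Level using (_⊔_)
import Relation.Binary.Construct.StrictToNonStrict as NonStrict
open import Relation.Binary.Definitions using (DecidableEquality; tri<; tri≈; tri>)
open import Relation.Binary.PropositionalEquality as ≡ using (_≡_; _≢_)
open import Relation.Binary.Structures using (IsStrictTotalOrder)
open import Relation.Nullary.Decidable using (Dec; yes; no; does; dec-true; dec-false; dec⇒maybe; decidable-stable; from-yes; map′; toSum; ¬?; _×-dec_; _⊎-dec_; _→-dec_)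
open import Relation.Nullary.Negation using (¬_; contradiction)
open import Relation.Unary using (Decidable)

-- A dissection D of the polytope covers every point off the planes spanned by
-- the vertices exactly once.  Hence, if finitely many such sample points carry
-- weights and w(T) is the total weight of the points in T, then the sum of w(T)
-- over T in D does not depend on D.  By linear programming duality each of the
-- three extremal dissections D₀ comes with weights and an integer k such that
-- w(T) ≥ k for all tetrahedra T, with equality only for T in D₀, and such that
-- the total weight is k |D₀|.  Then k |D| ≤ k |D₀|, and equality forces D = D₀;
-- this bounds |D| from above if k > 0 and from below if k < 0.  Since two
-- tetrahedra of D₀ do not meet in a common face, the size of a triangulation
-- differs from |D₀| by at least one, and explicit triangulations attain this.
-- That a given list of tetrahedra covers the polytope is seen by cutting it
-- along planes through vertices into cells each contained in one tetrahedron.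
-- All of this amounts to integer arithmetic, valid over every ordered field.

-- Both polytopes owe their behaviour to a planar quadrilateral: the unit square `s`, `e`, `n`, `w`
-- in the first, the parallelogram `w`, `s`, `e`, `n` in the plane x = z in the second. Each
-- extremal dissection cuts it along one diagonal on one side and along the other diagonal on the
-- other side, whereas in a triangulation the two diagonals cannot both occur. Volume cannot replace
-- the weights. In the first polytope it does give the bound 12, because lattice tetrahedra have
-- volume at least 1/6, but not uniqueness; in the second the pieces of the extremal dissections
-- have different volumes. Additivity of volume would also have to be established over an arbitrary
-- ordered field, whereas points only require signs. The price is that every sample must be strictly
-- inside or strictly outside each tetrahedron: a boundary point may lie in several closed pieces
-- and in the interior of none.

open Sum ℤ.+-*-semiring using () renaming (sum to ∑ℤ)

-- Ordered fields

module SemiringSum {c ℓ} (R : Semiring c ℓ) where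
  open Semiring R hiding (zero)
  open Sum R

  sum-zero : ∀ {n} {t : Vector Carrier n} → (∀ i → t i ≈ 0#) → sum t ≈ 0#
  sum-zero {ℕ.zero}  t≈0 = refl
  sum-zero {ℕ.suc n} t≈0 = trans (+-cong (t≈0 zero) (sum-zero (t≈0 ∘ suc))) (+-identityˡ 0#)

  sum-single : ∀ {n} (t : Vector Carrier n) i → (∀ j → j ≢ i → t j ≈ 0#) → sum t ≈ t i
  sum-single t zero    t≈0 = trans (+-congˡ (sum-zero (λ j → t≈0 (suc j) λ ()))) (+-identityʳ _)
  sum-single t (suc i) t≈0 = trans (+-cong (t≈0 zero λ ()) (sum-single (tail t) i (λ j j≢i → t≈0 (suc j) (j≢i ∘ Fin.suc-injective))))
                                   (+-identityˡ _)

module FieldProperties {c ℓ₁ ℓ₂} (K : OrderedField c ℓ₁ ℓ₂) where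
  open OrderedField K hiding (zero)
  open Geometry K using (fromℤ)
  open Mult semiring using (×-homo-+; ×1-homo-*) renaming (_×_ to _·_)
  open Sum semiring
  open SemiringSum semiring public
  open RingProperties ring
  open IsStrictTotalOrder isStrictTotalOrder public
    using (compare; <-respʳ-≈; <-respˡ-≈; irrefl) renaming (trans to <-trans; _≟_ to _≈?_)
  open import Relation.Binary.Reasoning.Setoid setoid

  fromℤ-neg : ∀ z → fromℤ (ℤ.- z) ≈ - fromℤ z
  fromℤ-neg (+ ℕ.zero) = sym -0#≈0#
  fromℤ-neg +[1+ n ]   = refl
  fromℤ-neg -[1+ n ]   = sym (-‿involutive _)

  fromℤ-⊖ : ∀ m n → fromℤ (m ℤ.⊖ n) ≈ m · 1# - n · 1#
  fromℤ-⊖ m ℕ.zero = begin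
    fromℤ (m ℤ.⊖ 0)  ≡⟨ ≡.cong fromℤ (ℤ.⊖-≥ (ℕ.z≤n {m})) ⟩
    m · 1#           ≈⟨ +-identityʳ _ ⟨
    m · 1# + 0#      ≈⟨ +-congˡ -0#≈0# ⟨
    m · 1# - 0#      ∎
  fromℤ-⊖ ℕ.zero (ℕ.suc n) = sym (+-identityˡ _)
  fromℤ-⊖ (ℕ.suc m) (ℕ.suc n) = begin
    fromℤ (ℕ.suc m ℤ.⊖ ℕ.suc n)        ≡⟨ ≡.cong fromℤ (ℤ.[1+m]⊖[1+n]≡m⊖n m n) ⟩
    fromℤ (m ℤ.⊖ n)                    ≈⟨ fromℤ-⊖ m n ⟩
    m · 1# - n · 1#                    ≈⟨ +-identityˡ _ ⟨
    0# + (m · 1# - n · 1#)             ≈⟨ +-congʳ (-‿inverseʳ 1#) ⟨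
    (1# - 1#) + (m · 1# - n · 1#)      ≈⟨ interchange _ _ _ _ ⟩
    (1# + m · 1#) + (- 1# - n · 1#)    ≈⟨ +-congˡ (-‿+-comm _ _) ⟩
    ℕ.suc m · 1# - ℕ.suc n · 1#        ∎
    where open CommutativeSemigroupProperties +-commutativeSemigroup using (interchange)

  fromℤ-+ : ∀ y z → fromℤ (y ℤ.+ z) ≈ fromℤ y + fromℤ z
  fromℤ-+ (+ m)    (+ n)    = ×-homo-+ 1# m n
  fromℤ-+ (+ m)    -[1+ n ] = fromℤ-⊖ m (ℕ.suc n)
  fromℤ-+ -[1+ m ] (+ n)    = trans (fromℤ-⊖ n (ℕ.suc m)) (+-comm _ _)
  fromℤ-+ -[1+ m ] -[1+ n ] = begin
    - (ℕ.suc (ℕ.suc (m ℕ.+ n)) · 1#)             ≡⟨ ≡.cong (λ k → - (k · 1#)) (≡.cong ℕ.suc (ℕ.+-suc m n)) ⟨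
    - ((ℕ.suc m ℕ.+ ℕ.suc n) · 1#)               ≈⟨ -‿cong (×-homo-+ 1# (ℕ.suc m) (ℕ.suc n)) ⟩
    - (ℕ.suc m · 1# + ℕ.suc n · 1#)              ≈⟨ -‿+-comm _ _ ⟨
    - (ℕ.suc m · 1#) - ℕ.suc n · 1#              ∎

  fromℤ-*ₙ : ∀ m z → fromℤ (+ m ℤ.* z) ≈ fromℤ (+ m) * fromℤ z
  fromℤ-*ₙ m (+ n)    = trans (reflexive (≡.cong fromℤ (≡.sym (ℤ.pos-* m n)))) (×1-homo-* m n)
  fromℤ-*ₙ m -[1+ n ] = begin
    fromℤ (+ m ℤ.* -[1+ n ])          ≡⟨ ≡.cong fromℤ (ℤ.neg-distribʳ-* (+ m) +[1+ n ]) ⟨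
    fromℤ (ℤ.- (+ m ℤ.* +[1+ n ]))    ≈⟨ fromℤ-neg (+ m ℤ.* +[1+ n ]) ⟩
    - fromℤ (+ m ℤ.* +[1+ n ])        ≈⟨ -‿cong (fromℤ-*ₙ m +[1+ n ]) ⟩
    - (fromℤ (+ m) * fromℤ +[1+ n ])  ≈⟨ -‿distribʳ-* _ _ ⟩
    fromℤ (+ m) * fromℤ -[1+ n ]      ∎

  fromℤ-* : ∀ y z → fromℤ (y ℤ.* z) ≈ fromℤ y * fromℤ z
  fromℤ-* (+ m)    z = fromℤ-*ₙ m z
  fromℤ-* -[1+ m ] z = begin
    fromℤ (-[1+ m ] ℤ.* z)        ≡⟨ ≡.cong fromℤ (ℤ.neg-distribˡ-* +[1+ m ] z) ⟨
    fromℤ (ℤ.- (+[1+ m ] ℤ.* z))  ≈⟨ fromℤ-neg (+[1+ m ] ℤ.* z) ⟩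
    - fromℤ (+[1+ m ] ℤ.* z)      ≈⟨ -‿cong (fromℤ-*ₙ (ℕ.suc m) z) ⟩
    - (fromℤ +[1+ m ] * fromℤ z)  ≈⟨ -‿distribˡ-* _ _ ⟩
    fromℤ -[1+ m ] * fromℤ z      ∎

  fromℤ-1 : fromℤ 1ℤ ≈ 1#
  fromℤ-1 = +-identityʳ 1#

  private
    fromℤ-homomorphism : ℤ.+-*-rawRing -Raw-AlmostCommutative⟶ fromCommutativeRing commutativeRing
    fromℤ-homomorphism = record
      { ⟦_⟧    = fromℤ
      ; +-homo = fromℤ-+
      ; *-homo = fromℤ-*
      ; -‿homo = fromℤ-neg
      ; 0-homo = refl
      ; 1-homo = fromℤ-1
      }

  -- Coefficients are taken in ℤ, where equality is decided by computation, unlike in an abstract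
  -- field.
  open Solver ℤ.+-*-rawRing (fromCommutativeRing commutativeRing) fromℤ-homomorphism
    (λ y z → Maybe.map (reflexive ∘ ≡.cong fromℤ) (dec⇒maybe (y ℤ.≟ z))) public
    using (solve; _:=_; _:+_; _:*_; _:-_; :-_)

  ≤-total : ∀ x y → x ≤ y ⊎ y ≤ x
  ≤-total = NonStrict.total _≈_ _<_ compare

  ≤-respʳ-≈ : ∀ {x y z} → y ≈ z → x ≤ y → x ≤ z
  ≤-respʳ-≈ = NonStrict.≤-respʳ-≈ _≈_ _<_ trans <-respʳ-≈

  <⇒≱ : ∀ {x y} → x < y → ¬ (y ≤ x)
  <⇒≱ x<y (inj₁ y<x) = irrefl refl (<-trans x<y y<x)
  <⇒≱ x<y (inj₂ y≈x) = irrefl (sym y≈x) x<y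

  pos+nonneg : ∀ {x y} → 0# < x → 0# ≤ y → 0# < x + y
  pos+nonneg {x} 0<x (inj₁ 0<y) = <-trans 0<x (<-respˡ-≈ (+-identityʳ x) (+-monoʳ-< x 0<y))
  pos+nonneg {x} 0<x (inj₂ 0≈y) = <-respʳ-≈ (trans (sym (+-identityʳ x)) (+-congˡ 0≈y)) 0<x

  nonneg+nonneg : ∀ {x y} → 0# ≤ x → 0# ≤ y → 0# ≤ x + y
  nonneg+nonneg (inj₁ 0<x) 0≤y = inj₁ (pos+nonneg 0<x 0≤y)
  nonneg+nonneg (inj₂ 0≈x) 0≤y = ≤-respʳ-≈ (trans (sym (+-identityˡ _)) (+-congʳ 0≈x)) 0≤y

  nonneg*nonneg : ∀ {x y} → 0# ≤ x → 0# ≤ y → 0# ≤ x * y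
  nonneg*nonneg (inj₁ 0<x) (inj₁ 0<y) = inj₁ (*-positive 0<x 0<y)
  nonneg*nonneg (inj₂ 0≈x) _          = inj₂ (trans (sym (zeroˡ _)) (*-congʳ 0≈x))
  nonneg*nonneg _          (inj₂ 0≈y) = inj₂ (trans (sym (zeroʳ _)) (*-congˡ 0≈y))

  x<y⇒0<y-x : ∀ {x y} → x < y → 0# < y - x
  x<y⇒0<y-x {x} {y} x<y = <-respˡ-≈ (-‿inverseˡ x) (<-respʳ-≈ (+-comm _ _) (+-monoʳ-< (- x) x<y))

  x≤y⇒0≤y-x : ∀ {x y} → x ≤ y → 0# ≤ y - x
  x≤y⇒0≤y-x (inj₁ x<y) = inj₁ (x<y⇒0<y-x x<y)
  x≤y⇒0≤y-x (inj₂ x≈y) = inj₂ (trans (sym (-‿inverseʳ _)) (+-congʳ x≈y))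

  0<y-x⇒x<y : ∀ {x y} → 0# < y - x → x < y
  0<y-x⇒x<y {x} {y} 0<y-x = <-respˡ-≈ (+-identityʳ x)
    (<-respʳ-≈ (solve 2 (λ x y → x :+ (y :- x) := y) refl x y) (+-monoʳ-< x 0<y-x))

  neg⇒-pos : ∀ {x} → x < 0# → 0# < - x
  neg⇒-pos x<0 = <-respʳ-≈ (+-identityˡ _) (x<y⇒0<y-x x<0)

  nonpos⇒-nonneg : ∀ {x} → x ≤ 0# → 0# ≤ - x
  nonpos⇒-nonneg (inj₁ x<0) = inj₁ (neg⇒-pos x<0)
  nonpos⇒-nonneg (inj₂ x≈0) = inj₂ (trans (sym -0#≈0#) (-‿cong (sym x≈0)))

  nonneg∧-nonneg⇒0 : ∀ {x} → 0# ≤ x → 0# ≤ - x → x ≈ 0#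
  nonneg∧-nonneg⇒0 (inj₂ 0≈x) _ = sym 0≈x
  nonneg∧-nonneg⇒0 (inj₁ 0<x) 0≤-x =
    contradiction (inj₂ (-‿inverseʳ _)) (<⇒≱ (pos+nonneg 0<x 0≤-x))

  1≢0 : ¬ (1# ≈ 0#)
  1≢0 1≈0 = irrefl (sym 1≈0) 0#<1#

  -- A negative `y` would make `x * (- y)` positive, yet 1 plus this product is zero.
  positive-inverse : ∀ {x} → 0# < x → ∃ λ y → 0# < y × x * y ≈ 1#
  positive-inverse {x} 0<x with inverse x (λ x≈0 → irrefl (sym x≈0) 0<x)
  ... | y , xy≈1 with compare 0# y
  ...   | tri< 0<y _ _ = y , 0<y , xy≈1
  ...   | tri≈ _ 0≈y _ = contradiction (trans (sym xy≈1) (trans (*-congˡ (sym 0≈y)) (zeroʳ x))) 1≢0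
  ...   | tri> _ _ y<0 = contradiction
    (inj₂ (trans (+-congˡ (trans (sym (-‿distribʳ-* x y)) (-‿cong xy≈1))) (-‿inverseʳ 1#)))
    (<⇒≱ (pos+nonneg 0#<1# (inj₁ (*-positive 0<x (neg⇒-pos y<0)))))

  *-cancel-zero : ∀ {x y} → 0# < x → x * y ≈ 0# → y ≈ 0#
  *-cancel-zero {x} {y} 0<x xy≈0 with positive-inverse 0<x
  ... | x⁻¹ , _ , xx⁻¹≈1 = begin
    y              ≈⟨ *-identityˡ y ⟨
    1# * y         ≈⟨ *-congʳ xx⁻¹≈1 ⟨
    (x * x⁻¹) * y  ≈⟨ solve 3 (λ x z y → (x :* z) :* y := z :* (x :* y)) refl x x⁻¹ y ⟩
    x⁻¹ * (x * y)  ≈⟨ *-congˡ xy≈0 ⟩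
    x⁻¹ * 0#       ≈⟨ zeroʳ x⁻¹ ⟩
    0#             ∎

  *-cancel-nonneg : ∀ {x y} → 0# < x → 0# ≤ x * y → 0# ≤ y
  *-cancel-nonneg {x} {y} 0<x 0≤xy with ≤-total 0# y
  ... | inj₁ 0≤y = 0≤y
  ... | inj₂ y≤0 = inj₂ (sym (*-cancel-zero 0<x (nonneg∧-nonneg⇒0 0≤xy
    (≤-respʳ-≈ (sym (-‿distribʳ-* x y)) (nonneg*nonneg (inj₁ 0<x) (nonpos⇒-nonneg y≤0))))))

  fromℤ-nonneg : ∀ {z} → 0ℤ ℤ.≤ z → 0# ≤ fromℤ z
  fromℤ-nonneg {+ ℕ.zero}  _ = inj₂ refl
  fromℤ-nonneg {+[1+ n ]}  _ = inj₁ (pos+nonneg 0#<1# (fromℤ-nonneg (ℤ.+≤+ (ℕ.z≤n {n}))))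

  fromℤ-pos : ∀ {z} → 0ℤ ℤ.< z → 0# < fromℤ z
  fromℤ-pos {+ ℕ.zero} (ℤ.+<+ ())
  fromℤ-pos {+[1+ n ]} _ = pos+nonneg 0#<1# (fromℤ-nonneg (ℤ.+≤+ (ℕ.z≤n {n})))

  fromℤ-neg-< : ∀ {z} → z ℤ.< 0ℤ → fromℤ z < 0#
  fromℤ-neg-< {+ n} (ℤ.+<+ ())
  fromℤ-neg-< { -[1+ n ]} _ = <-respˡ-≈ (+-identityˡ _) (<-respʳ-≈ (-‿inverseʳ _)
    (<-respˡ-≈ (+-comm _ _) (<-respʳ-≈ (+-comm _ _) (+-monoʳ-< _ (fromℤ-pos {+[1+ n ]} (ℤ.+<+ ℕ.z<s))))))

  -- The way back from the field to the integers: a fact about points over `K` can refute an integer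
  -- inequality.
  fromℤ-reflects-nonneg : ∀ {z} → 0# ≤ fromℤ z → 0ℤ ℤ.≤ z
  fromℤ-reflects-nonneg {z} 0≤z = ℤ.≮⇒≥ (λ z<0 → <⇒≱ (fromℤ-neg-< z<0) 0≤z)

  fromℤ-reflects-0 : ∀ {z} → fromℤ z ≈ 0# → z ≡ 0ℤ
  fromℤ-reflects-0 {+ ℕ.zero} _ = ≡.refl
  fromℤ-reflects-0 {+[1+ n ]} z≈0 = contradiction (sym z≈0) (λ e → irrefl e (fromℤ-pos {+[1+ n ]} (ℤ.+<+ ℕ.z<s)))
  fromℤ-reflects-0 { -[1+ n ]} z≈0 = contradiction z≈0 (λ e → irrefl e (fromℤ-neg-< { -[1+ n ]} ℤ.-<+))

  sum-nonneg : ∀ {n} {t : Vector Carrier n} → (∀ i → 0# ≤ t i) → 0# ≤ sum t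
  sum-nonneg {ℕ.zero}  0≤t = inj₂ refl
  sum-nonneg {ℕ.suc n} 0≤t = nonneg+nonneg (0≤t zero) (sum-nonneg (0≤t ∘ suc))

  nonneg-sum-zero : ∀ {n} {t : Vector Carrier n} → (∀ i → 0# ≤ t i) → sum t ≈ 0# → ∀ i → t i ≈ 0#
  nonneg-sum-zero {ℕ.suc n} {t} 0≤t Σ≈0 = λ where
      zero    → t₀≈0
      (suc i) → nonneg-sum-zero (0≤t ∘ suc) (trans (trans (sym (+-identityˡ _)) (+-congʳ (sym t₀≈0))) Σ≈0) i
    where
    t₀≈0 : t zero ≈ 0#
    t₀≈0 = nonneg∧-nonneg⇒0 (0≤t zero) (≤-respʳ-≈
      (+-inverseˡ-unique _ _ (trans (+-comm _ _) Σ≈0)) (sum-nonneg (0≤t ∘ suc)))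

-- Affine forms and simplices

Homogeneous : Set
Homogeneous = Vec ℤ 4

homogenise : LatticePoint → Homogeneous
homogenise z = 1ℤ ∷ z

-- (a₀, a₁, a₂, a₃) stands for the affine function a₀ + a₁x₁ + a₂x₂ + a₃x₃.
Form : Set
Form = Vec ℤ 4

infix 8 _∙_
_∙_ : ∀ {m} → Vec ℤ m → Vec ℤ m → ℤ
f ∙ s = ∑ℤ (λ k → lookup f k ℤ.* lookup s k)

scalar : ∀ {n} → ℤ → Fin n → Fin n → ℤ
scalar d i j = if does (i Fin.≟ j) then d else 0ℤ

scalar-≡ : ∀ {n} d (i : Fin n) → scalar d i i ≡ d
scalar-≡ d i with i Fin.≟ i
... | yes _  = ≡.refl
... | no i≢i = contradiction ≡.refl i≢i

scalar-≢ : ∀ {n} d {i j : Fin n} → i ≢ j → scalar d i j ≡ 0ℤ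
scalar-≢ d {i} {j} i≢j with i Fin.≟ j
... | yes i≡j = contradiction i≡j i≢j
... | no  _   = ≡.refl

commonFactor : ∀ {n} → (Fin n → Form) → ℤ
commonFactor N = ∑ℤ (λ i → lookup (N i) 0F)

module _ {n} (p : LatticePoints n) where

  vertex : Fin n → Homogeneous
  vertex i = homogenise (lookup p i)

  -- The forms N i are the barycentric coordinates with respect to T times a
  -- common factor; this factor is their sum, hence its constant coefficient.
  record IsBarycentric (T : Subset n) (N : Fin n → Form) : Set where
    constructor barycentric
    field
      positive   : 0ℤ ℤ.< commonFactor N
      vanishing  : ∀ i → i ∉ T → ∀ k → lookup (N i) k ≡ 0ℤ
      dual       : ∀ i j → j ∈ T → N i ∙ vertex j ≡ scalar (commonFactor N) i j
      resolution : ∀ k l → ∑ℤ (λ i → lookup (N i) l ℤ.* lookup (vertex i) k) ≡ scalar (commonFactor N) k l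

  -- Both inequalities are weak because the tetrahedra may share vertices. The zero form qualifies
  -- too, so disjointness of interiors needs the nonconstancy added in `WeaklySeparates`.
  Separates : Form → Subset n → Subset n → Set
  Separates f T T′ = (∀ i → i ∈ T → 0ℤ ℤ.≤ f ∙ vertex i) × (∀ i → i ∈ T′ → f ∙ vertex i ℤ.≤ 0ℤ)

infixl 6 _⊞_ _⊟_
_⊞_ _⊟_ : Form → Form → Form
_⊞_ = zipWith ℤ._+_
_⊟_ = zipWith ℤ._-_

opposite : ∀ {m} → Vec ℤ m → Vec ℤ m
opposite = map (λ z → ℤ.- z)

opposite-∙ : ∀ {m} (f s : Vec ℤ m) → opposite f ∙ s ≡ ℤ.- (f ∙ s)
opposite-∙ []      []      = ≡.refl
opposite-∙ (a ∷ f) (b ∷ s) = ≡.trans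
  (≡.cong₂ ℤ._+_ (≡.sym (ℤ.neg-distribˡ-* a b)) (opposite-∙ f s))
  (≡.sym (ℤ.neg-distrib-+ (a ℤ.* b) (f ∙ s)))

opposite-nonneg : ∀ {m} (f s : Vec ℤ m) → f ∙ s ℤ.≤ 0ℤ → 0ℤ ℤ.≤ opposite f ∙ s
opposite-nonneg f s fs≤0 = ℤ.≤-trans (ℤ.neg-mono-≤ fs≤0) (ℤ.≤-reflexive (≡.sym (opposite-∙ f s)))

-- Affine forms, convex hulls and interiors over an ordered field

module AffineGeometry {c ℓ₁ ℓ₂} (K : OrderedField c ℓ₁ ℓ₂) where
  open OrderedField K hiding (zero)
  open Geometry K
  open FieldProperties K
  open Sum semiring
  open RingProperties ring using (-‿involutive; -‿distribˡ-*; -‿distribʳ-*; -0#≈0#; -1*x≈-x)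
  open import Relation.Binary.Reasoning.Setoid setoid

  hom : Point → Vector Carrier 4
  hom x zero    = 1#
  hom x (suc k) = x k

  eval : ∀ {m} → Vec ℤ m → Vector Carrier m → Carrier
  eval f X = sum (λ k → fromℤ (lookup f k) * X k)

  infix 9 ⟦_⟧
  ⟦_⟧ : Form → Point → Carrier
  ⟦ f ⟧ x = eval f (hom x)

  eval-cong : ∀ {m} (f : Vec ℤ m) {X Y} → (∀ k → X k ≈ Y k) → eval f X ≈ eval f Y
  eval-cong f X≈Y = sum-cong-≋ (λ k → *-congˡ (X≈Y k))

  hom-cong : ∀ {x y} → x ≋ y → ∀ k → hom x k ≈ hom y k
  hom-cong x≋y zero    = refl
  hom-cong x≋y (suc k) = x≋y k

  eval-zero : ∀ {m} (f : Vec ℤ m) → (∀ k → lookup f k ≡ 0ℤ) → ∀ X → eval f X ≈ 0#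
  eval-zero f f≡0 X = sum-zero (λ k → trans (*-congʳ (reflexive (≡.cong fromℤ (f≡0 k)))) (zeroˡ _))

  -- One proof for `_⊞_` and `_⊟_`, with `s` equal to 1 and to -1.
  eval-zipWith : ∀ (_∘ℤ_ : ℤ → ℤ → ℤ) (s : Carrier) →
                 (∀ y z → fromℤ (y ∘ℤ z) ≈ fromℤ y + s * fromℤ z) →
                 ∀ {m} (f g : Vec ℤ m) X → eval (zipWith _∘ℤ_ f g) X ≈ eval f X + s * eval g X
  eval-zipWith _∘ℤ_ s homo f g X = begin
    eval (zipWith _∘ℤ_ f g) X
      ≈⟨ sum-cong-≋ (λ k → trans (*-congʳ (trans (reflexive (≡.cong fromℤ (Vec.lookup-zipWith _∘ℤ_ k f g))) (homo _ _)))
          (solve 4 (λ a b s x → (a :+ s :* b) :* x := a :* x :+ s :* (b :* x)) refl _ _ _ _)) ⟩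
    sum (λ k → fromℤ (lookup f k) * X k + s * (fromℤ (lookup g k) * X k))
      ≈⟨ ∑-distrib-+ (λ k → fromℤ (lookup f k) * X k) (λ k → s * (fromℤ (lookup g k) * X k)) ⟩
    eval f X + sum (λ k → s * (fromℤ (lookup g k) * X k))
      ≈⟨ +-congˡ (*-distribˡ-sum s (λ k → fromℤ (lookup g k) * X k)) ⟨
    eval f X + s * eval g X ∎

  eval-+ : ∀ {m} (f : Vec ℤ m) X Y → eval f (λ k → X k + Y k) ≈ eval f X + eval f Y
  eval-+ f X Y = trans (sum-cong-≋ (λ k → distribˡ (fromℤ (lookup f k)) (X k) (Y k)))
    (∑-distrib-+ (λ k → fromℤ (lookup f k) * X k) (λ k → fromℤ (lookup f k) * Y k))

  fromℤ-sum : ∀ {m} (t : Fin m → ℤ) → fromℤ (∑ℤ t) ≈ sum (fromℤ ∘ t)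
  fromℤ-sum {ℕ.zero}  t = refl
  fromℤ-sum {ℕ.suc m} t = trans (fromℤ-+ (t zero) (∑ℤ (t ∘ suc))) (+-congˡ (fromℤ-sum (t ∘ suc)))

  fromℤ-∙ : ∀ {m} (f s : Vec ℤ m) → fromℤ (f ∙ s) ≈ eval f (λ k → fromℤ (lookup s k))
  fromℤ-∙ f s = trans (fromℤ-sum (λ k → lookup f k ℤ.* lookup s k)) (sum-cong-≋ (λ k → fromℤ-* (lookup f k) (lookup s k)))

  Combination : ∀ {n m} → (Fin n → Vec ℤ m) → Vector Carrier n → Vector Carrier m → Set ℓ₁
  Combination v w X = ∀ k → sum (λ i → w i * fromℤ (lookup (v i) k)) ≈ X k

  -- In homogeneous coordinates an affine form is linear, so it passes through the combination;
  -- coordinate 0 carries the condition that the weights sum to 1.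
  eval-combination : ∀ {n m} (v : Fin n → Vec ℤ m) {w X} → Combination v w X →
                     ∀ f → eval f X ≈ sum (λ i → w i * fromℤ (f ∙ v i))
  eval-combination v {w} {X} wv≈X f = begin
    sum (λ k → a k * X k)                          ≈⟨ sum-cong-≋ (λ k → *-congˡ (wv≈X k)) ⟨
    sum (λ k → a k * sum (λ i → w i * v′ i k))     ≈⟨ sum-cong-≋ (λ k → *-distribˡ-sum (a k) (λ i → w i * v′ i k)) ⟩
    sum (λ k → sum (λ i → a k * (w i * v′ i k)))   ≈⟨ ∑-comm (λ k i → a k * (w i * v′ i k)) ⟩
    sum (λ i → sum (λ k → a k * (w i * v′ i k)))   ≈⟨ sum-cong-≋ (λ i → sum-cong-≋ (λ k →
      solve 3 (λ a w v → a :* (w :* v) := w :* (a :* v)) refl (a k) (w i) (v′ i k))) ⟩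
    sum (λ i → sum (λ k → w i * (a k * v′ i k)))   ≈⟨ sum-cong-≋ (λ i → *-distribˡ-sum (w i) (λ k → a k * v′ i k)) ⟨
    sum (λ i → w i * sum (λ k → a k * v′ i k))     ≈⟨ sum-cong-≋ (λ i → *-congˡ (fromℤ-∙ f (v i))) ⟨
    sum (λ i → w i * fromℤ (f ∙ v i))              ∎
    where
    a = λ k → fromℤ (lookup f k)
    v′ = λ i k → fromℤ (lookup (v i) k)

  _⊹_ : Point → Point → Point
  (x ⊹ e) k = x k + e k

  gradient : Form → Point → Carrier
  gradient (_ ∷ a) e = eval a e

  eval-translate : ∀ f x e → ⟦ f ⟧ (x ⊹ e) ≈ ⟦ f ⟧ x + gradient f e
  eval-translate (_ ∷ a) x e = trans (+-congˡ (eval-+ a x e)) (sym (+-assoc _ _ _))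

  Interior-point : ∀ {ℓ} {S : Point → Set ℓ} {x} → Interior S x → S x
  Interior-point {x = x} (ε , 0<ε , box) = box x λ k →
    0<y-x⇒x<y (<-respʳ-≈ (solve 2 (λ x ε → ε := x :- (x :- ε)) refl (x k) ε) 0<ε) ,
    0<y-x⇒x<y (<-respʳ-≈ (solve 2 (λ x ε → ε := (x :+ ε) :- x) refl (x k) ε) 0<ε)

  Interior-mono : ∀ {ℓ ℓ′} {S : Point → Set ℓ} {S′ : Point → Set ℓ′} →
                  (∀ y → S y → S′ y) → ∀ {x} → Interior S x → Interior S′ x
  Interior-mono S⊆S′ (ε , 0<ε , box) = ε , 0<ε , λ y y∈box → S⊆S′ y (box y y∈box)

  shrink : ∀ {ε ε′} {x y : Carrier} → ε ≤ ε′ → x - ε < y × y < x + ε → x - ε′ < y × y < x + ε′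
  shrink {ε} {ε′} {x} {y} ε≤ε′ (x-ε<y , y<x+ε) =
    0<y-x⇒x<y (<-respʳ-≈ (solve 4 (λ ε ε′ x y → (y :- (x :- ε)) :+ (ε′ :- ε) := y :- (x :- ε′)) refl ε ε′ x y)
      (pos+nonneg (x<y⇒0<y-x x-ε<y) 0≤ε′-ε)) ,
    0<y-x⇒x<y (<-respʳ-≈ (solve 4 (λ ε ε′ x y → ((x :+ ε) :- y) :+ (ε′ :- ε) := (x :+ ε′) :- y) refl ε ε′ x y)
      (pos+nonneg (x<y⇒0<y-x y<x+ε) 0≤ε′-ε))
    where
    0≤ε′-ε = x≤y⇒0≤y-x ε≤ε′

  Interior-∩ : ∀ {ℓ ℓ′} {S : Point → Set ℓ} {S′ : Point → Set ℓ′} {x} →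
               Interior S x → Interior S′ x → Interior (λ y → S y × S′ y) x
  Interior-∩ (ε , 0<ε , box) (ε′ , 0<ε′ , box′) with ≤-total ε ε′
  ... | inj₁ ε≤ε′ = ε  , 0<ε  , λ y y∈box → box y y∈box , box′ y (λ k → shrink ε≤ε′ (y∈box k))
  ... | inj₂ ε′≤ε = ε′ , 0<ε′ , λ y y∈box → box y (λ k → shrink ε′≤ε (y∈box k)) , box′ y y∈box

  Interior-⋂ : ∀ {ℓ m} {S : Fin m → Point → Set ℓ} {x} →
               (∀ i → Interior (S i) x) → Interior (λ y → ∀ i → S i y) x
  Interior-⋂ {m = ℕ.zero}  int = 1# , 0#<1# , λ _ _ ()
  Interior-⋂ {m = ℕ.suc m} int = Interior-mono (λ y → λ { (s , ss) zero → s ; (s , ss) (suc i) → ss i })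
    (Interior-∩ (int zero) (Interior-⋂ (int ∘ suc)))

  -- `B` is the ℓ¹-norm of `a`: on a box of radius ε each product of a coefficient with a
  -- displacement is at least minus its absolute value times ε.
  gradient-bound : ∀ {m} (a : Vec ℤ m) → ∃ λ B → 0# ≤ B ×
                   (∀ {ε} (e : Vector Carrier m) → (∀ k → 0# ≤ ε + e k × 0# ≤ ε - e k) → 0# ≤ B * ε + eval a e)
  gradient-bound [] = 0# , inj₂ refl , λ {ε} e _ → inj₂ (sym (trans (+-identityʳ _) (zeroˡ ε)))
  gradient-bound (a ∷ as) with ≤-total 0# (fromℤ a) | gradient-bound as
  ... | inj₁ 0≤a | B , 0≤B , bound = fromℤ a + B , nonneg+nonneg 0≤a 0≤B , λ {ε} e e∈box →
    ≤-respʳ-≈ (solve 5 (λ a ε e B r → a :* (ε :+ e) :+ (B :* ε :+ r) := (a :+ B) :* ε :+ (a :* e :+ r))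
                refl (fromℤ a) ε (e zero) B (eval as (e ∘ suc)))
      (nonneg+nonneg (nonneg*nonneg 0≤a (proj₁ (e∈box zero))) (bound (e ∘ suc) (e∈box ∘ suc)))
  ... | inj₂ a≤0 | B , 0≤B , bound = - fromℤ a + B , nonneg+nonneg (nonpos⇒-nonneg a≤0) 0≤B , λ {ε} e e∈box →
    ≤-respʳ-≈ (solve 5 (λ a ε e B r → (:- a) :* (ε :- e) :+ (B :* ε :+ r) := (:- a :+ B) :* ε :+ (a :* e :+ r))
                refl (fromℤ a) ε (e zero) B (eval as (e ∘ suc)))
      (nonneg+nonneg (nonneg*nonneg (nonpos⇒-nonneg a≤0) (proj₂ (e∈box zero))) (bound (e ∘ suc) (e∈box ∘ suc)))

  -- The radius is `⟦ f ⟧ x` divided by 1 + `B`. The 1 keeps the divisor positive even for a zero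
  -- gradient, and it leaves one ε to spare, which makes the inequality strict.
  halfspace-open : ∀ f {x} → 0# < ⟦ f ⟧ x → Interior (λ y → 0# < ⟦ f ⟧ y) x
  halfspace-open f@(_ ∷ a) {x} 0<fx with gradient-bound a
  ... | B , 0≤B , bound with positive-inverse (pos+nonneg 0#<1# 0≤B)
  ...   | r , 0<r , [1+B]r≈1 = ε , 0<ε , λ y y∈box →
    let e : Point
        e k = y k - x k
    in <-respʳ-≈ (begin
         ε + (B * ε + eval a e)                   ≈⟨ +-assoc _ _ _ ⟨
         (ε + B * ε) + eval a e                   ≈⟨ +-congʳ (trans (+-congʳ (sym (*-identityˡ ε))) (sym (distribʳ ε 1# B))) ⟩
         (1# + B) * ε + eval a e                  ≈⟨ +-congʳ scale ⟩
         ⟦ f ⟧ x + eval a e                       ≈⟨ eval-translate f x e ⟨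
         ⟦ f ⟧ (x ⊹ e)                            ≈⟨ eval-cong f (hom-cong (λ k → solve 2 (λ x y → x :+ (y :- x) := y) refl (x k) (y k))) ⟩
         ⟦ f ⟧ y                                  ∎)
       (pos+nonneg 0<ε (bound e (λ k →
         inj₁ (<-respʳ-≈ (solve 3 (λ x y ε → y :- (x :- ε) := ε :+ (y :- x)) refl (x k) (y k) ε)
           (x<y⇒0<y-x (proj₁ (y∈box k)))) ,
         inj₁ (<-respʳ-≈ (solve 3 (λ x y ε → (x :+ ε) :- y := ε :- (y :- x)) refl (x k) (y k) ε)
           (x<y⇒0<y-x (proj₂ (y∈box k)))))))
    where
    ε : Carrier
    ε = r * ⟦ f ⟧ x
    0<ε : 0# < ε
    0<ε = *-positive 0<r 0<fx
    scale : (1# + B) * ε ≈ ⟦ f ⟧ x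
    scale = trans (sym (*-assoc _ _ _)) (trans (*-congʳ [1+B]r≈1) (*-identityˡ _))

  module _ {n} (p : LatticePoints n) where
    private
      V : Fin n → Point
      V = embedAll p

    conv⇒combination : ∀ {T x} → ((w , _) : conv V T x) → Combination (vertex p) w (hom x)
    conv⇒combination (w , _ , _ , Σw≈1 , Σwv≈x) zero    =
      trans (sum-cong-≋ (λ i → trans (*-congˡ fromℤ-1) (*-identityʳ (w i)))) Σw≈1
    conv⇒combination (w , _ , _ , Σw≈1 , Σwv≈x) (suc k) = Σwv≈x k

    combination⇒conv : ∀ {T x w} → (∀ i → 0# ≤ w i) → (∀ i → i ∉ T → w i ≈ 0#) →
                       Combination (vertex p) w (hom x) → conv V T x
    combination⇒conv {w = w} 0≤w w≈0 wV≈x = w , 0≤w , w≈0 ,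
      trans (sum-cong-≋ (λ i → sym (trans (*-congˡ fromℤ-1) (*-identityʳ (w i))))) (wV≈x zero) ,
      wV≈x ∘ suc

    weighted-nonneg : ∀ {T x} ((w , _) : conv V T x) f → (∀ i → i ∈ T → 0ℤ ℤ.≤ f ∙ vertex p i) →
                      ∀ i → 0# ≤ w i * fromℤ (f ∙ vertex p i)
    weighted-nonneg {T} (w , 0≤w , w≈0 , _) f 0≤f i with i ∈? T
    ... | yes i∈T = nonneg*nonneg (0≤w i) (fromℤ-nonneg (0≤f i i∈T))
    ... | no  i∉T = inj₂ (sym (trans (*-congʳ (w≈0 i i∉T)) (zeroˡ _)))

    conv-nonneg : ∀ {T x} f → (∀ i → i ∈ T → 0ℤ ℤ.≤ f ∙ vertex p i) → conv V T x → 0# ≤ ⟦ f ⟧ x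
    conv-nonneg f 0≤f x∈T = ≤-respʳ-≈ (sym (eval-combination (vertex p) (conv⇒combination x∈T) f))
      (sum-nonneg (weighted-nonneg x∈T f 0≤f))

    conv-mono : ∀ {T T′ x} → T ⊆ T′ → conv V T x → conv V T′ x
    conv-mono T⊆T′ (w , 0≤w , w≈0 , rest) = w , 0≤w , (λ i i∉T′ → w≈0 i (i∉T′ ∘ T⊆T′)) , rest

    -- The value at `x` is a sum of nonnegative terms, weight times value at a vertex. If it is
    -- zero, every vertex with a positive value has weight zero.
    conv-face : ∀ {T F x} f → (∀ i → i ∈ T → 0ℤ ℤ.≤ f ∙ vertex p i) →
                (∀ i → i ∈ T → f ∙ vertex p i ≡ 0ℤ → i ∈ F) →
                ⟦ f ⟧ x ≈ 0# → conv V T x → conv V F x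
    conv-face {T} {F} f 0≤f f≡0⇒F fx≈0 x∈T@(w , 0≤w , w≈0 , rest) = w , 0≤w , supported , rest
      where
      supported : ∀ i → i ∉ F → w i ≈ 0#
      supported i i∉F with i ∈? T
      ... | no  i∉T = w≈0 i i∉T
      ... | yes i∈T = *-cancel-zero (fromℤ-pos (ℤ.≤∧≢⇒< (0≤f i i∈T) (λ 0≡f → i∉F (f≡0⇒F i i∈T (≡.sym 0≡f)))))
        (trans (*-comm _ _) (nonneg-sum-zero (weighted-nonneg x∈T f 0≤f)
          (trans (sym (eval-combination (vertex p) (conv⇒combination x∈T) f)) fx≈0) i))

  eval-⊞ : ∀ f g x → ⟦ f ⊞ g ⟧ x ≈ ⟦ f ⟧ x + ⟦ g ⟧ x
  eval-⊞ f g x = trans (eval-zipWith ℤ._+_ 1# (λ y z → trans (fromℤ-+ y z) (+-congˡ (sym (*-identityˡ _)))) f g (hom x))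
    (+-congˡ (*-identityˡ _))

  eval-⊟ : ∀ f g x → ⟦ f ⊟ g ⟧ x ≈ ⟦ f ⟧ x - ⟦ g ⟧ x
  eval-⊟ f g x = trans (eval-zipWith ℤ._-_ (- 1#) (λ y z → trans (fromℤ-+ y (ℤ.- z))
    (+-congˡ (trans (fromℤ-neg z) (sym (-1*x≈-x _))))) f g (hom x))
    (+-congˡ (-1*x≈-x _))

  eval-opposite : ∀ {m} (f : Vec ℤ m) X → eval (opposite f) X ≈ - eval f X
  eval-opposite []      X = sym -0#≈0#
  eval-opposite (a ∷ f) X = trans (+-cong (*-congʳ (fromℤ-neg a)) (eval-opposite f (X ∘ suc)))
    (solve 3 (λ a x r → (:- a) :* x :+ (:- r) := :- (a :* x :+ r)) refl (fromℤ a) (X zero) (eval f (X ∘ suc)))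

  -- The reciprocal of the leading coordinate turns integer homogeneous coordinates into a point
  -- over `K`. It is positive, so a form at this point has the sign of the integer `f ∙ s`.
  record Fraction (s : Homogeneous) : Set (c ⊔ ℓ₁ ⊔ ℓ₂) where
    field
      reciprocal : Carrier
      positive   : 0# < reciprocal
      isInverse  : fromℤ (lookup s 0F) * reciprocal ≈ 1#

    dehomogenise : Point
    dehomogenise k = reciprocal * fromℤ (lookup s (suc k))

    eval-dehomogenise : ∀ f → ⟦ f ⟧ dehomogenise ≈ reciprocal * fromℤ (f ∙ s)
    eval-dehomogenise f = begin
      eval f (hom dehomogenise)
        ≈⟨ eval-cong f {hom dehomogenise} {λ k → reciprocal * fromℤ (lookup s k)} (λ { zero → sym (trans (*-comm reciprocal _) isInverse) ; (suc k) → refl }) ⟩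
      eval f (λ k → reciprocal * fromℤ (lookup s k))
        ≈⟨ sum-cong-≋ (λ k → solve 3 (λ a r s → a :* (r :* s) := r :* (a :* s)) refl (fromℤ (lookup f k)) reciprocal (fromℤ (lookup s k))) ⟩
      sum (λ k → reciprocal * (fromℤ (lookup f k) * fromℤ (lookup s k)))
        ≈⟨ *-distribˡ-sum reciprocal (λ k → fromℤ (lookup f k) * fromℤ (lookup s k)) ⟨
      reciprocal * eval f (λ k → fromℤ (lookup s k))
        ≈⟨ *-congˡ (fromℤ-∙ f s) ⟨
      reciprocal * fromℤ (f ∙ s) ∎

    eval-nonneg : ∀ f → 0ℤ ℤ.≤ f ∙ s → 0# ≤ ⟦ f ⟧ dehomogenise
    eval-nonneg f 0≤fs = ≤-respʳ-≈ (sym (eval-dehomogenise f)) (nonneg*nonneg (inj₁ positive) (fromℤ-nonneg 0≤fs))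

    eval-pos : ∀ f → 0ℤ ℤ.< f ∙ s → 0# < ⟦ f ⟧ dehomogenise
    eval-pos f 0<fs = <-respʳ-≈ (sym (eval-dehomogenise f)) (*-positive positive (fromℤ-pos 0<fs))

    eval-reflects-nonneg : ∀ f → 0# ≤ ⟦ f ⟧ dehomogenise → 0ℤ ℤ.≤ f ∙ s
    eval-reflects-nonneg f 0≤fx =
      fromℤ-reflects-nonneg (*-cancel-nonneg positive (≤-respʳ-≈ (eval-dehomogenise f) 0≤fx))

  fraction : ∀ s → 0ℤ ℤ.< lookup s 0F → Fraction s
  fraction s 0<d with positive-inverse (fromℤ-pos 0<d)
  ... | r , 0<r , dr≈1 = record { reciprocal = r ; positive = 0<r ; isInverse = dr≈1 }

  module _ {n} (p : LatticePoints n) where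
    private
      V : Fin n → Point
      V = embedAll p

    module Simplex {T : Subset n} {N : Fin n → Form} (isBarycentric : IsBarycentric p T N) where
      open IsBarycentric isBarycentric

      private
        D : Carrier
        D = fromℤ (commonFactor N)

        0<D : 0# < D
        0<D = fromℤ-pos positive

      -- Duality leaves only the term j = i. For barycentric weights this computes the coordinates
      -- of a point; for an affine dependence it shows that the dependence is trivial.
      dual-sum : ∀ {m : Vector Carrier n} → (∀ i → i ∉ T → m i ≈ 0#) →
                 ∀ i → sum (λ j → m j * fromℤ (N i ∙ vertex p j)) ≈ D * m i
      dual-sum {m} m≈0 i = trans (sum-single _ i off) (on (i ∈? T))
        where
        off : ∀ j → j ≢ i → m j * fromℤ (N i ∙ vertex p j) ≈ 0#
        off j j≢i with j ∈? T
        ... | no  j∉T = trans (*-congʳ (m≈0 j j∉T)) (zeroˡ _)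
        ... | yes j∈T = trans (*-congˡ (reflexive (≡.cong fromℤ (≡.trans (dual i j j∈T) (scalar-≢ _ (j≢i ∘ ≡.sym)))))) (zeroʳ _)
        on : _ → m i * fromℤ (N i ∙ vertex p i) ≈ D * m i
        on (yes i∈T) = trans (*-congˡ (reflexive (≡.cong fromℤ (≡.trans (dual i i i∈T) (scalar-≡ _ i))))) (*-comm _ _)
        on (no  i∉T) = trans (*-congʳ (m≈0 i i∉T)) (trans (zeroˡ _) (sym (trans (*-congˡ (m≈0 i i∉T)) (zeroʳ D))))

      coordinate : ∀ {x} ((w , _) : conv V T x) i → ⟦ N i ⟧ x ≈ D * w i
      coordinate x∈T@(w , _ , w≈0 , _) i =
        trans (eval-combination (vertex p) (conv⇒combination p x∈T) (N i)) (dual-sum w≈0 i)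

      conv⇒nonneg : ∀ {x} → conv V T x → ∀ i → 0# ≤ ⟦ N i ⟧ x
      conv⇒nonneg x∈T@(w , 0≤w , _) i = ≤-respʳ-≈ (sym (coordinate x∈T i)) (nonneg*nonneg (inj₁ 0<D) (0≤w i))

      -- The values of the forms divided by `D` serve as weights. By `resolution` the transposed
      -- matrix of vertices times the matrix of forms is `D` times the identity, so these weights
      -- reproduce `x` and sum to 1.
      nonneg⇒conv : ∀ {x} → (∀ i → 0# ≤ ⟦ N i ⟧ x) → conv V T x
      nonneg⇒conv {x} 0≤Nx with positive-inverse 0<D
      ... | r , 0<r , Dr≈1 = combination⇒conv p
        (λ i → nonneg*nonneg (inj₁ 0<r) (0≤Nx i))
        (λ i i∉T → trans (*-congˡ (eval-zero (N i) (vanishing i i∉T) (hom x))) (zeroʳ r))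
        λ k → begin
          sum (λ i → (r * ⟦ N i ⟧ x) * h i k)                  ≈⟨ sum-cong-≋ (λ i → *-assoc r (⟦ N i ⟧ x) (h i k)) ⟩
          sum (λ i → r * (⟦ N i ⟧ x * h i k))                  ≈⟨ *-distribˡ-sum r (λ i → ⟦ N i ⟧ x * h i k) ⟨
          r * sum (λ i → ⟦ N i ⟧ x * h i k)                    ≈⟨ *-congˡ (resolve k) ⟩
          r * (D * hom x k)                                    ≈⟨ solve 3 (λ r D x → r :* (D :* x) := (D :* r) :* x) refl r D (hom x k) ⟩
          (D * r) * hom x k                                    ≈⟨ *-congʳ Dr≈1 ⟩
          1# * hom x k                                         ≈⟨ *-identityˡ (hom x k) ⟩
          hom x k                                              ∎
        where
        h = λ i k → fromℤ (lookup (vertex p i) k)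
        a = λ i l → fromℤ (lookup (N i) l)
        resolve : ∀ k → sum (λ i → ⟦ N i ⟧ x * h i k) ≈ D * hom x k
        resolve k = begin
          sum (λ i → ⟦ N i ⟧ x * h i k)
            ≈⟨ sum-cong-≋ (λ i → *-distribʳ-sum (h i k) (λ l → a i l * hom x l)) ⟩
          sum (λ i → sum (λ l → (a i l * hom x l) * h i k))
            ≈⟨ ∑-comm (λ i l → (a i l * hom x l) * h i k) ⟩
          sum (λ l → sum (λ i → (a i l * hom x l) * h i k))
            ≈⟨ sum-cong-≋ (λ l → trans (sum-cong-≋ (λ i → solve 3 (λ a x h → (a :* x) :* h := (a :* h) :* x) refl (a i l) (hom x l) (h i k)))
                 (sym (*-distribʳ-sum (hom x l) (λ i → a i l * h i k)))) ⟩
          sum (λ l → sum (λ i → a i l * h i k) * hom x l)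
            ≈⟨ sum-cong-≋ (λ l → *-congʳ {hom x l} (trans (sum-cong-≋ (λ i → sym (fromℤ-* (lookup (N i) l) (lookup (vertex p i) k))))
                 (trans (sym (fromℤ-sum (λ i → lookup (N i) l ℤ.* lookup (vertex p i) k))) (reflexive (≡.cong fromℤ (resolution k l)))))) ⟩
          sum (λ l → fromℤ (scalar (commonFactor N) k l) * hom x l)
            ≈⟨ sum-single (λ l → fromℤ (scalar (commonFactor N) k l) * hom x l) k
                 (λ l l≢k → trans (*-congʳ (reflexive (≡.cong fromℤ (scalar-≢ (commonFactor N) (l≢k ∘ ≡.sym))))) (zeroˡ (hom x l))) ⟩
          fromℤ (scalar (commonFactor N) k k) * hom x k
            ≈⟨ *-congʳ (reflexive (≡.cong fromℤ (scalar-≡ (commonFactor N) k))) ⟩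
          D * hom x k ∎

      affinelyIndependent : AffinelyIndependent V T
      affinelyIndependent m m≈0 Σm≈0 Σmv≈0 i = *-cancel-zero 0<D (begin
        D * m i                                        ≈⟨ dual-sum m≈0 i ⟨
        sum (λ j → m j * fromℤ (N i ∙ vertex p j))     ≈⟨ eval-combination (vertex p) {m} {λ _ → 0#} (λ
          { zero    → trans (sum-cong-≋ (λ j → trans (*-congˡ fromℤ-1) (*-identityʳ (m j)))) Σm≈0
          ; (suc k) → Σmv≈0 k }) (N i) ⟨
        eval (N i) (λ _ → 0#)                          ≈⟨ sum-zero {t = λ k → fromℤ (lookup (N i) k) * 0#} (λ k → zeroʳ _) ⟩
        0#                                             ∎)

      interior : ∀ {x} → (∀ i → i ∈ T → 0# < ⟦ N i ⟧ x) → Interior (conv V T) x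
      interior {x} 0<Nx = Interior-mono (λ y → nonneg⇒conv) (Interior-⋂ positive-near)
        where
        positive-near : ∀ i → Interior (λ y → 0# ≤ ⟦ N i ⟧ y) x
        positive-near i with i ∈? T
        ... | yes i∈T = Interior-mono (λ _ → inj₁) (halfspace-open (N i) (0<Nx i i∈T))
        -- Here `N i` is the zero form, nonnegative everywhere, so any radius serves.
        ... | no  i∉T = 1# , 0#<1# , λ y _ → inj₂ (sym (eval-zero (N i) (vanishing i i∉T) (hom y)))

      ∉-face : ∀ {x F i} → i ∉ F → F ⊆ T → 0# < ⟦ N i ⟧ x → ¬ conv V F x
      ∉-face {x} {F} {i} i∉F F⊆T 0<Nx x∈F@(w , _ , w≈0 , _) =
        irrefl (sym (trans (coordinate (conv-mono p F⊆T x∈F) i) (trans (*-congˡ (w≈0 i i∉F)) (zeroʳ D)))) 0<Nx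

    conv-nonpos : ∀ {T x} f → (∀ i → i ∈ T → f ∙ vertex p i ℤ.≤ 0ℤ) → conv V T x → 0# ≤ - ⟦ f ⟧ x
    conv-nonpos {T} {x} f f≤0 x∈T = ≤-respʳ-≈ (eval-opposite f (hom x))
      (conv-nonneg p (opposite f) (λ i i∈T → opposite-nonneg f (vertex p i) (f≤0 i i∈T)) x∈T)

    separated-zero : ∀ {f T T′ x} → Separates p f T T′ → conv V T x → conv V T′ x → ⟦ f ⟧ x ≈ 0#
    separated-zero {f} (0≤f , f≤0) x∈T x∈T′ = nonneg∧-nonneg⇒0 (conv-nonneg p f 0≤f x∈T) (conv-nonpos f f≤0 x∈T′)

    -- A common interior point lies on the plane f = 0. As f has nonzero slope along coordinate `k`,
    -- a step of half the radius in the descending direction stays in `T` but makes f negative.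
    separated-disjoint : ∀ {f T T′} → Separates p f T T′ → (∃ λ k → lookup f (suc k) ≢ 0ℤ) →
                         ¬ (∃ λ x → Interior (conv V T) x × Interior (conv V T′) x)
    separated-disjoint {f@(_ ∷ a)} sep@(0≤f , _) (k , aₖ≢0) (x , intT@(ε , 0<ε , box) , intT′) with
      positive-inverse (pos+nonneg 0#<1# (inj₁ 0#<1#))
    ... | r , 0<r , [1+1]r≈1 = irrefl (sym (-‿inverseˡ (aₖ * δ)))
        (pos+nonneg 0<-aδ (≤-respʳ-≈ fy≈aδ (conv-nonneg p f 0≤f (box (x ⊹ e) in-box))))
      where
      aₖ = fromℤ (lookup a k)
      h = ε * r
      0<h : 0# < h
      0<h = *-positive 0<ε 0<r
      ε≈h+h : ε ≈ h + h
      ε≈h+h = sym (begin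
        ε * r + ε * r          ≈⟨ distribˡ ε r r ⟨
        ε * (r + r)            ≈⟨ *-congˡ (+-cong (*-identityˡ r) (*-identityˡ r)) ⟨
        ε * (1# * r + 1# * r)  ≈⟨ *-congˡ (distribʳ r 1# 1#) ⟨
        ε * ((1# + 1#) * r)    ≈⟨ *-congˡ [1+1]r≈1 ⟩
        ε * 1#                 ≈⟨ *-identityʳ ε ⟩
        ε                      ∎)
      0<ε-h : 0# < ε - h
      0<ε-h = <-respʳ-≈ (trans (solve 1 (λ h → h := (h :+ h) :- h) refl h) (+-congʳ (sym ε≈h+h))) 0<h
      descent : ∃ λ δ → 0# < ε + δ × 0# < ε - δ × 0# < - (aₖ * δ)
      descent with compare aₖ 0#
      ... | tri< a<0 _ _ = h , pos+nonneg 0<ε (inj₁ 0<h) , 0<ε-h , <-respʳ-≈ (sym (-‿distribˡ-* aₖ h)) (*-positive (neg⇒-pos a<0) 0<h)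
      ... | tri≈ _ a≈0 _ = contradiction (fromℤ-reflects-0 a≈0) aₖ≢0
      ... | tri> _ _ 0<a = - h , 0<ε-h , <-respʳ-≈ (+-congˡ (sym (-‿involutive h))) (pos+nonneg 0<ε (inj₁ 0<h)) ,
        <-respʳ-≈ (solve 2 (λ a h → a :* h := :- (a :* (:- h))) refl aₖ h) (*-positive 0<a 0<h)
      δ = proj₁ descent
      0<-aδ = proj₂ (proj₂ (proj₂ descent))
      e : Point
      e j = if does (j Fin.≟ k) then δ else 0#
      e-k : e k ≈ δ
      e-k with k Fin.≟ k
      ... | yes _  = refl
      ... | no k≢k = contradiction ≡.refl k≢k
      e-≢ : ∀ j → j ≢ k → e j ≈ 0#
      e-≢ j j≢k with j Fin.≟ k
      ... | yes j≡k = contradiction j≡k j≢k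
      ... | no  _   = refl
      in-box : ∀ j → x j - ε < x j + e j × x j + e j < x j + ε
      in-box j = 0<y-x⇒x<y (<-respʳ-≈ (solve 3 (λ x ε e → ε :+ e := (x :+ e) :- (x :- ε)) refl (x j) ε (e j)) (proj₁ bound)) ,
                 0<y-x⇒x<y (<-respʳ-≈ (solve 3 (λ x ε e → ε :- e := (x :+ ε) :- (x :+ e)) refl (x j) ε (e j)) (proj₂ bound))
        where
        bound : 0# < ε + e j × 0# < ε - e j
        bound with j Fin.≟ k
        ... | yes _ = proj₁ (proj₂ descent) , proj₁ (proj₂ (proj₂ descent))
        ... | no  _ = <-respʳ-≈ (sym (+-identityʳ ε)) 0<ε , <-respʳ-≈ (sym (trans (+-congˡ -0#≈0#) (+-identityʳ ε))) 0<ε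
      fy≈aδ : ⟦ f ⟧ (x ⊹ e) ≈ aₖ * δ
      fy≈aδ = begin
        ⟦ f ⟧ (x ⊹ e)                      ≈⟨ eval-translate f x e ⟩
        ⟦ f ⟧ x + eval a e                 ≈⟨ +-congʳ (separated-zero {f} sep (Interior-point intT) (Interior-point intT′)) ⟩
        0# + eval a e                      ≈⟨ +-identityˡ _ ⟩
        eval a e                           ≈⟨ sum-single (λ j → fromℤ (lookup a j) * e j) k (λ j j≢k → trans (*-congˡ (e-≢ j j≢k)) (zeroʳ _)) ⟩
        aₖ * e k                           ≈⟨ *-congˡ e-k ⟩
        aₖ * δ                             ∎

    -- Common points lie on the plane f = 0, hence in the hull of those vertices of `T` that lie on
    -- it, and these belong to `F`.
    separated-meet : ∀ {f T T′ F} → Separates p f T T′ → F ⊆ T → F ⊆ T′ →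
                     (∀ i → i ∈ T → f ∙ vertex p i ≡ 0ℤ → i ∈ F) → MeetInCommonFace V T T′
    separated-meet {f} {T} {T′} {F} sep@(0≤f , _) F⊆T F⊆T′ f≡0⇒F = F , F⊆T , F⊆T′ , λ x → mk⇔
      (λ (x∈T , x∈T′) → conv-face p f 0≤f f≡0⇒F (separated-zero {f} sep x∈T x∈T′) x∈T)
      (λ x∈F → conv-mono p F⊆T x∈F , conv-mono p F⊆T′ x∈F)

-- Certificates

-- The affine form det(b - a, c - a, x - a) in x, expanded by linearity: its slopes are the
-- determinants at the unit vectors, its constant is minus the determinant at `a`.
plane : (a b c : LatticePoint) → Form
plane a b c = ℤ.- det a ∷ det (1ℤ ∷ 0ℤ ∷ 0ℤ ∷ []) ∷ det (0ℤ ∷ 1ℤ ∷ 0ℤ ∷ []) ∷ det (0ℤ ∷ 0ℤ ∷ 1ℤ ∷ []) ∷ []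
  where
  det : LatticePoint → ℤ
  det = det₃ (b ⊖ a) (c ⊖ a)

zeroForm : Form
zeroForm = replicate 4 0ℤ

spannedPlane : List LatticePoint → Form
spannedPlane (a ∷ b ∷ c ∷ []) = plane a b c
spannedPlane _                = zeroForm

orient : Homogeneous → Form → Form
orient s f = if does (f ∙ s ℤ.<? 0ℤ) then opposite f else f

choose : ∀ {A : Set} → ℕ → List A → List (List A)
choose ℕ.zero    _        = [] ∷ []
choose (ℕ.suc k) []       = []
choose (ℕ.suc k) (x ∷ xs) = List.map (x ∷_) (choose k xs) List.++ choose (ℕ.suc k) xs

_≟ₛ_ : ∀ {n} → DecidableEquality (Subset n)
_≟ₛ_ = Vec.≡-dec Bool._≟_

infix 4 _∈ₗ?_
_∈ₗ?_ : ∀ {n} (T : Subset n) (D : Simplices n) → Dec (T ∈ₗ D)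
_∈ₗ?_ = DecMembership._∈?_ _≟ₛ_

allSubset? : ∀ {n ℓ} {P : Subset n → Set ℓ} → Decidable P → Dec (∀ T → P T)
allSubset? {ℕ.zero}  P? = map′ (λ { P[] [] → P[] }) (λ P → P []) (P? [])
allSubset? {ℕ.suc n} P? = map′
  (λ { (P , _) (inside ∷ T) → P T ; (_ , P) (outside ∷ T) → P T })
  (λ P → P ∘ (inside ∷_) , P ∘ (outside ∷_))
  (allSubset? (P? ∘ (inside ∷_)) ×-dec allSubset? (P? ∘ (outside ∷_)))

∀∈? : ∀ {n ℓ} {P : Fin n → Set ℓ} (T : Subset n) → Decidable P → Dec (∀ i → i ∈ T → P i)
∀∈? T P? = Fin.all? (λ i → i ∈? T →-dec P? i)

range : ℤ → ℕ → List ℤ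
range lo m = List.map (λ j → lo ℤ.+ + j) (List.upTo (ℕ.suc m))

∈-range : ∀ {lo m z} → lo ℤ.≤ z → z ℤ.≤ lo ℤ.+ + m → z ∈ₗ range lo m
∈-range {lo} {m} {z} lo≤z z≤lo+m =
  ≡.subst (_∈ₗ range lo m) lo+j≡z (∈-map⁺ (λ j → lo ℤ.+ + j) (∈-upTo⁺ (ℕ.s≤s j≤m)))
  where
  j : ℕ
  j = ℤ.∣ z ℤ.- lo ∣
  +j≡z-lo : + j ≡ z ℤ.- lo
  +j≡z-lo = ℤ.0≤i⇒+∣i∣≡i (ℤ.i≤j⇒0≤j-i lo≤z)
  cancel : ∀ y → lo ℤ.+ y ℤ.- lo ≡ y
  cancel y = ≡.trans (≡.cong (ℤ._- lo) (ℤ.+-comm lo y)) (cancelʳ y lo)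
    where
    cancelʳ : ∀ x y → x ℤ.+ y ℤ.- y ≡ x
    cancelʳ = solve-∀
  j≤m : j ℕ.≤ m
  j≤m = ℤ.drop‿+≤+ (≡.subst₂ ℤ._≤_ (≡.sym +j≡z-lo) (cancel (+ m)) (ℤ.+-monoˡ-≤ (ℤ.- lo) z≤lo+m))
  lo+j≡z : lo ℤ.+ + j ≡ z
  lo+j≡z = ≡.trans (≡.cong (ℤ._+_ lo) +j≡z-lo) (add-back lo z)
    where
    add-back : ∀ x y → x ℤ.+ (y ℤ.- x) ≡ y
    add-back = solve-∀

coordinateForm : ℤ → ℤ → Fin 3 → Form
coordinateForm b a k = b ∷ tabulate (scalar a k)

coordinateForm-∙ : ∀ b a k z → coordinateForm b a k ∙ homogenise z ≡ b ℤ.+ a ℤ.* lookup z k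
coordinateForm-∙ b a k z = ≡.cong₂ ℤ._+_ (ℤ.*-identityʳ b) (≡.trans
  (sum-single (λ l → lookup (tabulate (scalar a k)) l ℤ.* lookup z l) k
    (λ l l≢k → ≡.cong (ℤ._* lookup z l) (≡.trans (Vec.lookup∘tabulate (scalar a k) l) (scalar-≢ a (l≢k ∘ ≡.sym)))))
  (≡.cong (ℤ._* lookup z k) (≡.trans (Vec.lookup∘tabulate (scalar a k) k) (scalar-≡ a k))))
  where open SemiringSum ℤ.+-*-semiring using (sum-single)

module Check {n} (p : LatticePoints n) where

  points : Subset n → List LatticePoint
  points T = go T p
    where
    go : ∀ {m} → Subset m → Vec LatticePoint m → List LatticePoint
    go []            []      = []
    go (inside  ∷ T) (z ∷ p) = z ∷ go T p
    go (outside ∷ T) (z ∷ p) = go T p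

  -- The plane through the other three vertices, oriented to be nonnegative at vertex `i`. Its value
  -- there is six times the volume of the tetrahedron, the same for every `i`; this is the common
  -- factor.
  barycentricForm : Subset n → Fin n → Form
  barycentricForm T i =
    if does (i ∈? T) then orient (vertex p i) (spannedPlane (points (T ∖ i))) else zeroForm

  barycentricForms : Subset n → Vec Form n
  barycentricForms T = tabulate (barycentricForm T)

  coordinates : Subset n → Fin n → Form
  coordinates T = lookup (barycentricForms T)

  isBarycentric? : ∀ T N → Dec (IsBarycentric p T N)
  isBarycentric? T N = map′
    (λ (a , b , c , d) → barycentric a b c d)
    (λ (barycentric a b c d) → a , b , c , d)
    (0ℤ ℤ.<? commonFactor N
      ×-dec Fin.all? (λ i → ¬? (i ∈? T) →-dec Fin.all? (λ k → lookup (N i) k ℤ.≟ 0ℤ))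
      ×-dec Fin.all? (λ i → ∀∈? T (λ j → N i ∙ vertex p j ℤ.≟ scalar (commonFactor N) i j))
      ×-dec Fin.all? (λ k → Fin.all? (λ l → ∑ℤ (λ i → lookup (N i) l ℤ.* lookup (vertex p i) k) ℤ.≟ scalar (commonFactor N) k l)))

  -- Both orientations are listed because `Separates` distinguishes the two sides.
  planes : List Form
  planes = concatMap (λ t → spannedPlane t ∷ opposite (spannedPlane t) ∷ []) (choose 3 (toList p))

  separates? : ∀ f T T′ → Dec (Separates p f T T′)
  separates? f T T′ = ∀∈? T (λ i → 0ℤ ℤ.≤? f ∙ vertex p i) ×-dec ∀∈? T′ (λ i → f ∙ vertex p i ℤ.≤? 0ℤ)

  -- The sum of all separating planes through three vertices lies in the
  -- relative interior of the cone of separating forms, so it vanishes on as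
  -- few vertices of T and T′ as any separating form.
  separator : List Form → Subset n → Subset n → Form
  separator fs T T′ = foldr _⊞_ zeroForm (filter (λ f → separates? f T T′) fs)

  WeaklySeparates : Form → Subset n → Subset n → Set
  WeaklySeparates f T T′ = Separates p f T T′ × ∃ λ (k : Fin 3) → lookup f (suc k) ≢ 0ℤ

  weaklySeparates? : ∀ f T T′ → Dec (WeaklySeparates f T T′)
  weaklySeparates? f T T′ = separates? f T T′ ×-dec Fin.any? (λ k → ¬? (lookup f (suc k) ℤ.≟ 0ℤ))

  -- Every vertex of `T` on the separating plane is also one of `T′`, which confines the
  -- intersection to the face spanned by `T ∩ T′`.
  SeparatesAtFace : Form → Subset n → Subset n → Set
  SeparatesAtFace f T T′ = Separates p f T T′ × (∀ i → i ∈ T → f ∙ vertex p i ≡ 0ℤ → i ∈ T′)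

  separatesAtFace? : ∀ f T T′ → Dec (SeparatesAtFace f T T′)
  separatesAtFace? f T T′ =
    separates? f T T′ ×-dec ∀∈? T (λ i → (f ∙ vertex p i ℤ.≟ 0ℤ) →-dec (i ∈? T′))

  -- The index `k` runs over homogeneous coordinates; k = 0 says that the coefficients sum to zero,
  -- so this is an affine dependence.
  Dependence : Subset n → Vec ℤ n → Set
  Dependence T m =
    (∃ λ i → lookup m i ≢ 0ℤ) × (∀ i → i ∉ T → lookup m i ≡ 0ℤ) ×
    (∀ k → ∑ℤ (λ i → lookup m i ℤ.* lookup (vertex p i) k) ≡ 0ℤ)

  dependence? : ∀ T m → Dec (Dependence T m)
  dependence? T m =
    Fin.any? (λ i → ¬? (lookup m i ℤ.≟ 0ℤ)) ×-dec
    Fin.all? (λ i → ¬? (i ∈? T) →-dec (lookup m i ℤ.≟ 0ℤ)) ×-dec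
    Fin.all? (λ k → ∑ℤ (λ i → lookup m i ℤ.* lookup (vertex p i) k) ℤ.≟ 0ℤ)

  -- A binary space partition by planes through three vertices. A leaf names a tetrahedron
  -- containing its cell; the same one may occur at several leaves, since cuts also run through
  -- tetrahedra.
  data Cover : Set where
    piece : Subset n → Cover
    cut   : (i j k : Fin n) → Cover → Cover → Cover

  -- A Farkas certificate for f ≥ 0 on the part of the polytope where the forms
  -- of the list are nonnegative, searched among the multipliers 0, 1 and 2.
  Implied : Form → List Form → Set
  Implied f []       = ∀ i → 0ℤ ℤ.≤ f ∙ vertex p i
  Implied f (g ∷ gs) = Implied f gs ⊎ Implied (f ⊟ g) gs ⊎ Implied (f ⊟ g ⊟ g) gs

  implied? : ∀ f gs → Dec (Implied f gs)
  implied? f []       = Fin.all? (λ i → 0ℤ ℤ.≤? f ∙ vertex p i)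
  implied? f (g ∷ gs) = implied? f gs ⊎-dec implied? (f ⊟ g) gs ⊎-dec implied? (f ⊟ g ⊟ g) gs

  -- Doubling N i allows for half-integral multipliers.
  InsidePiece : (Fin n → Form) → List Form → Set
  InsidePiece N gs = ∀ i → Implied (N i) gs ⊎ Implied (N i ⊞ N i) gs

  insidePiece? : ∀ N gs → Dec (InsidePiece N gs)
  insidePiece? N gs = Fin.all? (λ i → implied? (N i) gs ⊎-dec implied? (N i ⊞ N i) gs)

  -- The list `gs` collects the half-spaces chosen on the way down; their common part with the
  -- polytope is the current cell.
  Covers : Simplices n → List Form → Cover → Set
  Covers D gs (piece T)       = T ∈ₗ D × InsidePiece (coordinates T) gs
  Covers D gs (cut i j k l r) = Covers D (f ∷ gs) l × Covers D (opposite f ∷ gs) r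
    where f = plane (lookup p i) (lookup p j) (lookup p k)

  covers? : ∀ D gs t → Dec (Covers D gs t)
  covers? D gs (piece T)       = (T ∈ₗ? D) ×-dec insidePiece? (coordinates T) gs
  covers? D gs (cut i j k l r) = covers? D (f ∷ gs) l ×-dec covers? D (opposite f ∷ gs) r
    where f = plane (lookup p i) (lookup p j) (lookup p k)

  Dissects : Simplices n → Cover → Set
  Dissects D t =
    Unique D ×
    All (λ T → ∣ T ∣ ≡ 4 × IsBarycentric p T (coordinates T)) D ×
    AllPairs (λ T T′ → WeaklySeparates (separator planes T T′) T T′) D ×
    Covers D [] t

  dissects? : ∀ D t → Dec (Dissects D t)
  dissects? D t =
    DecUnique.unique? _≟ₛ_ D ×-dec
    All.all? (λ T → (∣ T ∣ ℕ.≟ 4) ×-dec isBarycentric? T (coordinates T)) D ×-dec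
    AllPairs.allPairs? (λ T T′ → weaklySeparates? (separator planes T T′) T T′) D ×-dec
    covers? D [] t

  Triangulates : Simplices n → Set
  Triangulates = AllPairs (λ T T′ → SeparatesAtFace (separator planes T T′) T T′)

  triangulates? : ∀ D → Dec (Triangulates D)
  triangulates? = AllPairs.allPairs? (λ T T′ → separatesAtFace? (separator planes T T′) T T′)

  Inside : (Fin n → Form) → Subset n → Homogeneous → Set
  Inside N T s = ∀ i → i ∈ T → 0ℤ ℤ.< N i ∙ s

  inside? : ∀ N T s → Dec (Inside N T s)
  inside? N T s = ∀∈? T (λ i → 0ℤ ℤ.<? N i ∙ s)

  -- Not the negation of `Inside`: a boundary point satisfies neither, so demanding one of the two
  -- also certifies that a sample avoids the boundary.
  Outside : (Fin n → Form) → Homogeneous → Set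
  Outside N s = ∃ λ i → N i ∙ s ℤ.< 0ℤ

  outside? : ∀ N s → Dec (Outside N s)
  outside? N s = Fin.any? (λ i → N i ∙ s ℤ.<? 0ℤ)

  Supports : Form → Fin n → Set
  Supports f i = f ∙ vertex p i ≡ 0ℤ × (∀ j → j ≢ i → 0ℤ ℤ.< f ∙ vertex p j)

  supports? : ∀ f i → Dec (Supports f i)
  supports? f i =
    (f ∙ vertex p i ℤ.≟ 0ℤ) ×-dec Fin.all? (λ j → ¬? (j Fin.≟ i) →-dec (0ℤ ℤ.<? f ∙ vertex p j))

  -- For `⊤` and `⁅ i ⁆` the separating planes are the facet planes through vertex `i`, so their sum
  -- vanishes at that vertex only.
  InConvexPosition : Set
  InConvexPosition = ∀ i → Supports (separator planes ⊤ ⁅ i ⁆) i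

  inConvexPosition? : Dec InConvexPosition
  inConvexPosition? = Fin.all? (λ i → supports? (separator planes ⊤ ⁅ i ⁆) i)

  -- A face of `T` containing the point `s` contains every vertex of `T` at which `s` has a positive
  -- coordinate. One such vertex outside `T′` rules out a common face.
  Crosses : (N N′ : Fin n → Form) → Subset n → Subset n → Homogeneous → Set
  Crosses N N′ T T′ s =
    0ℤ ℤ.< lookup s 0F × IsBarycentric p T N × IsBarycentric p T′ N′ ×
    (∀ i → 0ℤ ℤ.≤ N i ∙ s) × (∀ i → 0ℤ ℤ.≤ N′ i ∙ s) × ∃ λ i → i ∉ T′ × 0ℤ ℤ.< N i ∙ s

  crosses? : ∀ N N′ T T′ s → Dec (Crosses N N′ T T′ s)
  crosses? N N′ T T′ s =
    0ℤ ℤ.<? lookup s 0F ×-dec isBarycentric? T N ×-dec isBarycentric? T′ N′ ×-dec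
    Fin.all? (λ i → 0ℤ ℤ.≤? N i ∙ s) ×-dec Fin.all? (λ i → 0ℤ ℤ.≤? N′ i ∙ s) ×-dec
    Fin.any? (λ i → ¬? (i ∈? T′) ×-dec (0ℤ ℤ.<? N i ∙ s))

  -- In effect a facet inequality violated by `z`.
  Excluded : LatticePoint → Set
  Excluded z = Any (λ f → (∀ i → 0ℤ ℤ.≤ f ∙ vertex p i) × f ∙ homogenise z ℤ.< 0ℤ) planes

  excluded? : ∀ z → Dec (Excluded z)
  excluded? z = Any.any? (λ f → Fin.all? (λ i → 0ℤ ℤ.≤? f ∙ vertex p i) ×-dec (f ∙ homogenise z ℤ.<? 0ℤ)) planes

  Classified : LatticePoint → Set
  Classified z = (∃ λ i → z ≡ lookup p i) ⊎ Excluded z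

  classified? : ∀ z → Dec (Classified z)
  classified? z = Fin.any? (λ i → Vec.≡-dec ℤ._≟_ z (lookup p i)) ⊎-dec excluded? z

  InBox : ℤ → ℕ → Fin 3 → Set
  InBox lo m k = ∀ i → 0ℤ ℤ.≤ coordinateForm (ℤ.- lo) (+ 1) k ∙ vertex p i ×
                       0ℤ ℤ.≤ coordinateForm (lo ℤ.+ + m) (ℤ.- (+ 1)) k ∙ vertex p i

  inBox? : ∀ lo m k → Dec (InBox lo m k)
  inBox? lo m k = Fin.all? λ i → (0ℤ ℤ.≤? _) ×-dec (0ℤ ℤ.≤? _)

  EmptyLattice : Vec ℤ 3 → Vec ℕ 3 → Set
  EmptyLattice lo m =
    (∀ k → InBox (lookup lo k) (lookup m k) k) ×
    All (λ x → All (λ y → All (λ z → Classified (x ∷ y ∷ z ∷ [])) (range (lookup lo 2F) (lookup m 2F)))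
      (range (lookup lo 1F) (lookup m 1F))) (range (lookup lo 0F) (lookup m 0F))

  emptyLattice? : ∀ lo m → Dec (EmptyLattice lo m)
  emptyLattice? lo m =
    Fin.all? (λ k → inBox? (lookup lo k) (lookup m k) k) ×-dec
    All.all? (λ x → All.all? (λ y → All.all? (λ z → classified? (x ∷ y ∷ z ∷ []))
      (range (lookup lo 2F) (lookup m 2F))) (range (lookup lo 1F) (lookup m 1F))) (range (lookup lo 0F) (lookup m 0F))

-- Finite integer sums over lists

module _ {a} {A : Set a} where

  ∑ : (A → ℤ) → List A → ℤ
  ∑ f []       = 0ℤ
  ∑ f (x ∷ xs) = f x ℤ.+ ∑ f xs

  ∑-cong : ∀ {f g : A → ℤ} xs → (∀ {x} → x ∈ₗ xs → f x ≡ g x) → ∑ f xs ≡ ∑ g xs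
  ∑-cong []       f≡g = ≡.refl
  ∑-cong (x ∷ xs) f≡g = ≡.cong₂ ℤ._+_ (f≡g (here ≡.refl)) (∑-cong xs (f≡g ∘ there))

  ∑-const : ∀ k (xs : List A) → ∑ (const k) xs ≡ k ℤ.* + length xs
  ∑-const k []       = ≡.sym (ℤ.*-zeroʳ k)
  ∑-const k (x ∷ xs) = ≡.trans (≡.cong (ℤ._+_ k) (∑-const k xs)) (≡.sym (ℤ.*-suc k (+ length xs)))

  ∑-+ : ∀ (f g : A → ℤ) xs → ∑ (λ x → f x ℤ.+ g x) xs ≡ ∑ f xs ℤ.+ ∑ g xs
  ∑-+ f g []       = ≡.refl
  ∑-+ f g (x ∷ xs) = ≡.trans (≡.cong (ℤ._+_ (f x ℤ.+ g x)) (∑-+ f g xs)) (interchange (f x) (g x) (∑ f xs) (∑ g xs))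
    where open CommutativeSemigroupProperties ℤ.+-commutativeSemigroup using (interchange)

  ∑-mono-≤ : ∀ {f g : A → ℤ} xs → (∀ {x} → x ∈ₗ xs → f x ℤ.≤ g x) → ∑ f xs ℤ.≤ ∑ g xs
  ∑-mono-≤ []       f≤g = ℤ.≤-refl
  ∑-mono-≤ (x ∷ xs) f≤g = ℤ.+-mono-≤ (f≤g (here ≡.refl)) (∑-mono-≤ xs (f≤g ∘ there))

  -- Slack in one term could not be made up by the other terms.
  ∑-tight : ∀ {f g : A → ℤ} xs → (∀ {x} → x ∈ₗ xs → f x ℤ.≤ g x) → ∑ g xs ℤ.≤ ∑ f xs →
            ∀ {x} → x ∈ₗ xs → g x ℤ.≤ f x
  ∑-tight {f} {g} (x ∷ xs) f≤g Σg≤Σf (here ≡.refl) =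
    +-cancelʳ-≤ (∑ g xs) (ℤ.≤-trans Σg≤Σf (ℤ.+-monoʳ-≤ (f x) (∑-mono-≤ xs (f≤g ∘ there))))
    where
    +-cancelʳ-≤ : ∀ {i j} k → i ℤ.+ k ℤ.≤ j ℤ.+ k → i ℤ.≤ j
    +-cancelʳ-≤ {i} {j} k i+k≤j+k = ≡.subst₂ ℤ._≤_ (cancel i) (cancel j) (ℤ.+-monoˡ-≤ (ℤ.- k) i+k≤j+k)
      where
      cancel : ∀ i → i ℤ.+ k ℤ.+ ℤ.- k ≡ i
      cancel i = ≡.trans (ℤ.+-assoc i k (ℤ.- k)) (≡.trans (≡.cong (ℤ._+_ i) (ℤ.+-inverseʳ k)) (ℤ.+-identityʳ i))
  ∑-tight {f} {g} (x ∷ xs) f≤g Σg≤Σf (there x∈xs) =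
    ∑-tight xs (f≤g ∘ there) (ℤ.≤-trans (ℤ.≤-reflexive (≡.sym (cancel (∑ g xs))))
      (ℤ.≤-trans (ℤ.+-monoʳ-≤ (ℤ.- g x) (ℤ.≤-trans Σg≤Σf (ℤ.+-monoˡ-≤ (∑ f xs) (f≤g (here ≡.refl)))))
        (ℤ.≤-reflexive (cancel (∑ f xs))))) x∈xs
    where
    cancel : ∀ i → ℤ.- g x ℤ.+ (g x ℤ.+ i) ≡ i
    cancel i = ≡.trans (≡.sym (ℤ.+-assoc (ℤ.- g x) (g x) i)) (≡.trans (≡.cong (λ j → j ℤ.+ i) (ℤ.+-inverseˡ (g x))) (ℤ.+-identityˡ i))

  -- The summation form of being covered exactly once: `Unique` and the hypothesis on pairs exclude
  -- a second contribution.
  ∑-indicator : ∀ (b : A → Bool) y {xs} → Unique xs → (∀ {x x′} → x ∈ₗ xs → x′ ∈ₗ xs → b x ≡ true → b x′ ≡ true → x ≡ x′) →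
                ∀ {x} → x ∈ₗ xs → b x ≡ true → ∑ (λ x → if b x then y else 0ℤ) xs ≡ y
  ∑-indicator b y {x ∷ xs} (x∉xs ∷ unique) same x₀∈xs bx₀ with b x in bx
  ... | true = ≡.trans (≡.cong (ℤ._+_ y) (zeros xs (λ {x′} x′∈xs → none x′∈xs (b x′) ≡.refl))) (ℤ.+-identityʳ y)
    where
    none : ∀ {x′} → x′ ∈ₗ xs → ∀ v → b x′ ≡ v → b x′ ≡ false
    none x′∈xs false bx′ = bx′
    none x′∈xs true  bx′ = contradiction (same (here ≡.refl) (there x′∈xs) bx bx′) (All.lookup x∉xs x′∈xs)
    zeros : ∀ xs → (∀ {x′} → x′ ∈ₗ xs → b x′ ≡ false) → ∑ (λ x → if b x then y else 0ℤ) xs ≡ 0ℤ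
    zeros []        _   = ≡.refl
    zeros (x′ ∷ xs) b≡f rewrite b≡f {x′} (here ≡.refl) = ≡.trans (ℤ.+-identityˡ _) (zeros xs (b≡f ∘ there))
  ... | false with x₀∈xs
  ...   | here ≡.refl    = contradiction (≡.trans (≡.sym bx₀) bx) λ ()
  ...   | there x₀∈xs′ = ≡.trans (ℤ.+-identityˡ _)
    (∑-indicator b y unique (λ x∈ x′∈ → same (there x∈) (there x′∈)) x₀∈xs′ bx₀)

  allPairs-lookup : ∀ {ℓ} {R : A → A → Set ℓ} {xs x y} → AllPairs R xs → x ∈ₗ xs → y ∈ₗ xs → x ≢ y → R x y ⊎ R y x
  allPairs-lookup (Rx ∷ _)  (here ≡.refl) (here ≡.refl) x≢y = contradiction ≡.refl x≢y
  allPairs-lookup (Rx ∷ _)  (here ≡.refl) (there y∈)    x≢y = inj₁ (All.lookup Rx y∈)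
  allPairs-lookup (Rx ∷ _)  (there x∈)    (here ≡.refl) x≢y = inj₂ (All.lookup Rx x∈)
  allPairs-lookup (_  ∷ Rs) (there x∈)    (there y∈)    x≢y = allPairs-lookup Rs x∈ y∈ x≢y

∑-swap : ∀ {a b} {A : Set a} {B : Set b} (f : A → B → ℤ) xs ys →
         ∑ (λ x → ∑ (f x) ys) xs ≡ ∑ (λ y → ∑ (λ x → f x y) xs) ys
∑-swap f []       ys = ≡.sym (≡.trans (∑-const 0ℤ ys) ≡.refl)
∑-swap f (x ∷ xs) ys = ≡.trans (≡.cong (ℤ._+_ (∑ (f x) ys)) (∑-swap f xs ys)) (≡.sym (∑-+ (f x) _ ys))

-- Weighted sample points as dual certificates

module Weighing {n} (p : LatticePoints n) (N : Subset n → Fin n → Form) (k : ℤ) (samples : List (ℤ × Homogeneous)) where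
  open Check p

  weight : (Fin n → Form) → Subset n → ℤ
  weight F T = ∑ (λ (y , s) → if does (inside? F T s) then y else 0ℤ) samples

  -- The last clause is a dual constraint with strict complementary slackness; the middle clause
  -- keeps all samples off the boundary of `T`.
  Balanced : Simplices n → (Fin n → Form) → Subset n → Set
  Balanced D₀ F T =
    IsBarycentric p T F × All (λ (_ , s) → Inside F T s ⊎ Outside F s) samples ×
    (k ℤ.< weight F T ⊎ (k ≡ weight F T × T ∈ₗ D₀))

  balanced? : ∀ D₀ F T → Dec (Balanced D₀ F T)
  balanced? D₀ F T =
    isBarycentric? T F ×-dec All.all? (λ (_ , s) → inside? F T s ⊎-dec outside? F s) samples ×-dec
    ((k ℤ.<? weight F T) ⊎-dec ((k ℤ.≟ weight F T) ×-dec (T ∈ₗ? D₀)))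

  -- The first clause places the samples in the polytope. The second, a sample in every piece of
  -- `D₀`, later forces every dissection of extreme size to contain `D₀`. The last runs over all
  -- 4-subsets and dismisses the coplanar ones by a listed dependence.
  Weighs : List (Vec ℤ n) → Simplices n → Set
  Weighs dependences D₀ =
    All (λ (_ , s) → 0ℤ ℤ.< lookup s 0F × Any (λ T → Inside (N T) T s) D₀) samples ×
    All (λ T → Any (λ (_ , s) → Inside (N T) T s) samples) D₀ ×
    ∑ proj₁ samples ≡ k ℤ.* + length D₀ ×
    (∀ T → ∣ T ∣ ≡ 4 → Any (Dependence T) dependences ⊎ Balanced D₀ (N T) T)

  weighs? : ∀ ms D₀ → Dec (Weighs ms D₀)
  weighs? ms D₀ =
    All.all? (λ (_ , s) → (0ℤ ℤ.<? lookup s 0F) ×-dec Any.any? (λ T → inside? (N T) T s) D₀) samples ×-dec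
    All.all? (λ T → Any.any? (λ (_ , s) → inside? (N T) T s) samples) D₀ ×-dec
    (∑ proj₁ samples ℤ.≟ k ℤ.* + length D₀) ×-dec
    allSubset? (λ T → (∣ T ∣ ℕ.≟ 4) →-dec (Any.any? (dependence? T) ms ⊎-dec balanced? D₀ (N T) T))

does-true : ∀ {a} {A : Set a} (a? : Dec A) → does a? ≡ true → A
does-true (yes a) _ = a

-- Geometric soundness of the integer certificates

module Soundness {n} (p : LatticePoints n) {c ℓ₁ ℓ₂} (K : OrderedField c ℓ₁ ℓ₂) where
  open OrderedField K hiding (zero)
  open Geometry K
  open FieldProperties K
  open AffineGeometry K
  open Check p
  open Fraction using (dehomogenise)
  open RingProperties ring using (-0#≈0#; -‿+-comm)
  module S = Sum semiring
  open import Relation.Binary.Reasoning.Setoid setoid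

  V : Fin n → Point
  V = embedAll p

  eval-embed : ∀ f z → ⟦ f ⟧ (embed z) ≈ fromℤ (f ∙ homogenise z)
  eval-embed f z = trans
    (eval-cong f {hom (embed z)} {λ k → fromℤ (lookup (homogenise z) k)} (λ { zero → sym fromℤ-1 ; (suc k) → refl }))
    (sym (fromℤ-∙ f (homogenise z)))

  implied-nonneg : ∀ f gs {x} → Implied f gs → polytope V x → All (λ g → 0# ≤ ⟦ g ⟧ x) gs → 0# ≤ ⟦ f ⟧ x
  implied-nonneg f []       0≤f x∈P [] = conv-nonneg p f (λ i _ → 0≤f i) x∈P
  implied-nonneg f (g ∷ gs) {x} implied x∈P (0≤g ∷ 0≤gs) = [ (λ i → implied-nonneg f gs i x∈P 0≤gs) ,
    [ (λ i → raise f (implied-nonneg (f ⊟ g) gs i x∈P 0≤gs)) ,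
      (λ i → raise f (raise (f ⊟ g) (implied-nonneg (f ⊟ g ⊟ g) gs i x∈P 0≤gs))) ]′ ]′ implied
    where
    raise : ∀ f → 0# ≤ ⟦ f ⊟ g ⟧ x → 0# ≤ ⟦ f ⟧ x
    raise f 0≤f-g = ≤-respʳ-≈
      (trans (+-congʳ (eval-⊟ f g x)) (solve 2 (λ f g → (f :- g) :+ g := f) refl (⟦ f ⟧ x) (⟦ g ⟧ x)))
      (nonneg+nonneg 0≤f-g 0≤g)

  insidePiece-sound : ∀ {T gs x} → IsBarycentric p T (coordinates T) → InsidePiece (coordinates T) gs →
                      polytope V x → All (λ g → 0# ≤ ⟦ g ⟧ x) gs → conv V T x
  insidePiece-sound {T} {gs} {x} bary within x∈P 0≤gs = Simplex.nonneg⇒conv p bary λ i →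
    [ (λ implied → implied-nonneg (N i) gs implied x∈P 0≤gs) ,
      (λ implied → halve (≤-respʳ-≈ (eval-⊞ (N i) (N i) x) (implied-nonneg (N i ⊞ N i) gs implied x∈P 0≤gs))) ]′ (within i)
    where
    N = coordinates T
    halve : ∀ {y} → 0# ≤ y + y → 0# ≤ y
    halve {y} 0≤y+y = *-cancel-nonneg (pos+nonneg 0#<1# (inj₁ 0#<1#))
      (≤-respʳ-≈ (sym (trans (distribʳ y 1# 1#) (+-cong (*-identityˡ y) (*-identityˡ y)))) 0≤y+y)

  -- The order of `K` is total, so every point lies on one side of each cut; a point on the plane
  -- may follow either branch.
  covers-sound : ∀ {D} → All (λ T → IsBarycentric p T (coordinates T)) D → ∀ gs t → Covers D gs t →
                 ∀ {x} → polytope V x → All (λ g → 0# ≤ ⟦ g ⟧ x) gs → Any (λ T → conv V T x) D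
  covers-sound bary gs (piece T) (T∈D , within) x∈P 0≤gs =
    lose T∈D (insidePiece-sound (All.lookup bary T∈D) within x∈P 0≤gs)
  covers-sound bary gs (cut i j k l r) (left , right) {x} x∈P 0≤gs =
    [ (λ 0≤f → covers-sound bary (f ∷ gs) l left x∈P (0≤f ∷ 0≤gs)) ,
      (λ f≤0 → covers-sound bary (opposite f ∷ gs) r right x∈P
        (≤-respʳ-≈ (sym (eval-opposite f (hom x))) (nonpos⇒-nonneg f≤0) ∷ 0≤gs)) ]′
    (≤-total 0# (⟦ f ⟧ x))
    where
    f : Form
    f = plane (lookup p i) (lookup p j) (lookup p k)

  weaklySeparates⇒disjoint : ∀ f T T′ → WeaklySeparates f T T′ →
                             ¬ (∃ λ x → Interior (conv V T) x × Interior (conv V T′) x)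
  weaklySeparates⇒disjoint f T T′ (sep , nonconstant) = separated-disjoint p {f} {T} {T′} sep nonconstant

  dissects⇒isDissection : ∀ {D t} → Dissects D t → IsDissection V D
  dissects⇒isDissection {D} {t} (unique , simplices , separated , covered) =
    unique ,
    All.map (λ (∣T∣≡4 , bary) → ∣T∣≡4 , Simplex.affinelyIndependent p bary) simplices ,
    (λ {T} {T′} T∈D T′∈D T≢T′ →
      [ weaklySeparates⇒disjoint (separator planes T T′) T T′ ,
        (λ sep (x , x∈T , x∈T′) → weaklySeparates⇒disjoint (separator planes T′ T) T′ T sep (x , x∈T′ , x∈T)) ]′
      (allPairs-lookup separated T∈D T′∈D T≢T′)) ,
    (λ x → mk⇔ (λ x∈P → covers-sound (All.map proj₂ simplices) [] t covered x∈P [])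
      (λ x∈D → conv-mono p (λ _ → ∈⊤) (proj₂ (proj₂ (find x∈D)))))

  -- Disjointness of interiors is a negative statement; decidable equality of index sets makes it
  -- positive.
  overlap⇒≡ : ∀ {D} → IsDissection V D → ∀ {T T′} → T ∈ₗ D → T′ ∈ₗ D →
              ∀ x → Interior (conv V T) x → Interior (conv V T′) x → T ≡ T′
  overlap⇒≡ (_ , _ , disjoint , _) {T} {T′} T∈D T′∈D x x∈T x∈T′ =
    decidable-stable (T ≟ₛ T′) (λ T≢T′ → disjoint T∈D T′∈D T≢T′ (x , x∈T , x∈T′))

  meet-sym : ∀ {T T′} → MeetInCommonFace V T T′ → MeetInCommonFace V T′ T
  meet-sym (F , F⊆T , F⊆T′ , meet) = F , F⊆T′ , F⊆T , λ x → mk⇔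
    (λ (x∈T′ , x∈T) → Equivalence.to (meet x) (x∈T , x∈T′))
    (λ x∈F → let x∈T , x∈T′ = Equivalence.from (meet x) x∈F in x∈T′ , x∈T)

  meet-refl : ∀ T → MeetInCommonFace V T T
  meet-refl T = T , (λ i∈T → i∈T) , (λ i∈T → i∈T) , λ x → mk⇔ proj₁ (λ x∈T → x∈T , x∈T)

  separatesAtFace⇒meet : ∀ f T T′ → SeparatesAtFace f T T′ → MeetInCommonFace V T T′
  separatesAtFace⇒meet f T T′ (sep , f≡0⇒T′) = separated-meet p {f} {T} {T′} {T ∩ T′} sep
    (p∩q⊆p T T′) (p∩q⊆q T T′) (λ i i∈T f≡0 → x∈p∩q⁺ (i∈T , f≡0⇒T′ i i∈T f≡0))

  triangulates⇒isTriangulation : ∀ {D} → IsDissection V D → Triangulates D → IsTriangulation V D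
  triangulates⇒isTriangulation {D} dissection pairs = dissection , meet
    where
    meet : ∀ {T T′} → T ∈ₗ D → T′ ∈ₗ D → MeetInCommonFace V T T′
    meet {T} {T′} T∈D T′∈D = meet? (T ≟ₛ T′)
      where
      meet? : Dec (T ≡ T′) → MeetInCommonFace V T T′
      meet? (yes T≡T′) = ≡.subst (MeetInCommonFace V T) T≡T′ (meet-refl T)
      meet? (no  T≢T′) = [ separatesAtFace⇒meet (separator planes T T′) T T′ ,
        meet-sym {T′} {T} ∘ separatesAtFace⇒meet (separator planes T′ T) T′ T ]′ (allPairs-lookup pairs T∈D T′∈D T≢T′)

  module _ {T : Subset n} {N : Fin n → Form} (bary : IsBarycentric p T N) (s : Homogeneous) (0<d : 0ℤ ℤ.< lookup s 0F) where
    private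
      x = dehomogenise (fraction s 0<d)

    inside⇒interior : Inside N T s → Interior (conv V T) x
    inside⇒interior within = Simplex.interior p bary (λ i i∈T → Fraction.eval-pos (fraction s 0<d) (N i) (within i i∈T))

    outside⇒∉conv : Outside N s → ¬ conv V T x
    outside⇒∉conv (i , Ns<0) x∈T = ℤ.<⇒≱ Ns<0
      (Fraction.eval-reflects-nonneg (fraction s 0<d) (N i) (Simplex.conv⇒nonneg p bary x∈T i))

  dependence⇒¬independent : ∀ T m → Dependence T m → ¬ AffinelyIndependent V T
  dependence⇒¬independent T m ((i , mᵢ≢0) , m≡0 , Σmv≡0) independent =
    mᵢ≢0 (fromℤ-reflects-0 (independent (λ i → fromℤ (lookup m i))
      (λ i i∉T → reflexive (≡.cong fromℤ (m≡0 i i∉T)))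
      (trans (S.sum-cong-≋ {n} {λ i → fromℤ (lookup m i)} {λ i → fromℤ (lookup m i) * fromℤ 1ℤ}
        (λ i → trans (sym (*-identityʳ _)) (*-congˡ (sym fromℤ-1)))) (dependent 0F))
      (λ k → dependent (suc k)) i))
    where
    dependent : ∀ k → S.sum (λ i → fromℤ (lookup m i) * fromℤ (lookup (vertex p i) k)) ≈ 0#
    dependent k = begin
      S.sum (λ i → fromℤ (lookup m i) * fromℤ (lookup (vertex p i) k))  ≈⟨ S.sum-cong-≋ (λ i → fromℤ-* (lookup m i) (lookup (vertex p i) k)) ⟨
      S.sum (λ i → fromℤ (lookup m i ℤ.* lookup (vertex p i) k))        ≈⟨ fromℤ-sum (λ i → lookup m i ℤ.* lookup (vertex p i) k) ⟨
      fromℤ (∑ℤ (λ i → lookup m i ℤ.* lookup (vertex p i) k))           ≡⟨ ≡.cong fromℤ (Σmv≡0 k) ⟩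
      0#                                                                ∎

  crosses⇒¬meet : ∀ N N′ T T′ s → Crosses N N′ T T′ s → ¬ MeetInCommonFace V T T′
  crosses⇒¬meet N N′ T T′ s (0<d , bary , bary′ , 0≤N , 0≤N′ , i , i∉T′ , 0<Nᵢ) (F , F⊆T , F⊆T′ , meet) =
    Simplex.∉-face p bary {x} {F} {i} (i∉T′ ∘ F⊆T′) F⊆T (Fraction.eval-pos (fraction s 0<d) (N i) 0<Nᵢ)
      (Equivalence.to (meet x)
        ( Simplex.nonneg⇒conv p bary (λ i → Fraction.eval-nonneg (fraction s 0<d) (N i) (0≤N i))
        , Simplex.nonneg⇒conv p bary′ (λ i → Fraction.eval-nonneg (fraction s 0<d) (N′ i) (0≤N′ i))))
    where
    x : Point
    x = dehomogenise (fraction s 0<d)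

  unit : Fin n → Vector Carrier n
  unit i j = if does (i Fin.≟ j) then 1# else 0#

  unit-≡ : ∀ i → unit i i ≈ 1#
  unit-≡ i = reflexive (≡.cong (if_then 1# else 0#) (dec-true (i Fin.≟ i) ≡.refl))

  unit-≢ : ∀ {i j} → j ≢ i → unit i j ≈ 0#
  unit-≢ {i} {j} j≢i = reflexive (≡.cong (if_then 1# else 0#) (dec-false (i Fin.≟ j) (j≢i ∘ ≡.sym)))

  vertex∈conv : ∀ {T i} → i ∈ T → conv V T (V i)
  vertex∈conv {T} {i} i∈T = unit i ,
    (λ j → [ (λ j≡i → ≤-respʳ-≈ (sym (trans (reflexive (≡.cong (unit i) j≡i)) (unit-≡ i))) (inj₁ 0#<1#)) ,
             (λ j≢i → inj₂ (sym (unit-≢ {i} {j} j≢i))) ]′ (toSum (j Fin.≟ i))) ,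
    (λ j j∉T → unit-≢ {i} {j} λ { ≡.refl → j∉T i∈T }) ,
    trans (sum-single (unit i) i (λ j → unit-≢ {i} {j})) (unit-≡ i) ,
    λ k → trans (sum-single (λ j → unit i j * V j k) i (λ j j≢i → trans (*-congʳ (unit-≢ {i} {j} j≢i)) (zeroˡ _)))
      (trans (*-congʳ (unit-≡ i)) (*-identityˡ _))

  conv-resp : ∀ {T x y} → x ≋ y → conv V T x → conv V T y
  conv-resp x≋y (w , 0≤w , w≈0 , Σw≈1 , Σwv≈x) = w , 0≤w , w≈0 , Σw≈1 , λ k → trans (Σwv≈x k) (x≋y k)

  conv-singleton : ∀ {i x} → conv V ⁅ i ⁆ x → x ≋ V i
  conv-singleton {i} {x} (w , _ , w≈0 , Σw≈1 , Σwv≈x) k = begin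
    x k                          ≈⟨ Σwv≈x k ⟨
    S.sum (λ j → w j * V j k)    ≈⟨ sum-single (λ j → w j * V j k) i (λ j j≢i → trans (*-congʳ (others j j≢i)) (zeroˡ _)) ⟩
    w i * V i k                  ≈⟨ *-congʳ (trans (sym (sum-single w i others)) Σw≈1) ⟩
    1# * V i k                   ≈⟨ *-identityˡ _ ⟩
    V i k                        ∎
    where
    others : ∀ j → j ≢ i → w j ≈ 0#
    others j j≢i = w≈0 j (j≢i ∘ x∈⁅y⁆⇒x≡y i)

  -- The sign is reversed because `IsVertex` asks for a maximum, while a supporting form has its
  -- minimum 0 at the vertex.
  gradientVector : Form → Point
  gradientVector f k = fromℤ (lookup (opposite f) (suc k))

  gradientVector-difference : ∀ f x y → ⟨ gradientVector f , x ⟩ - ⟨ gradientVector f , y ⟩ ≈ ⟦ f ⟧ y - ⟦ f ⟧ x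
  gradientVector-difference (a ∷ as) x y = begin
    eval (opposite as) x - eval (opposite as) y  ≈⟨ +-cong (eval-opposite as x) (-‿cong (eval-opposite as y)) ⟩
    - eval as x - - eval as y                    ≈⟨ solve 3 (λ a x y → (:- x) :- (:- y) := (a :+ y) :- (a :+ x)) refl (fromℤ a * 1#) (eval as x) (eval as y) ⟩
    ⟦ a ∷ as ⟧ y - ⟦ a ∷ as ⟧ x                  ∎

  inner-combination : ∀ {x} ((w , _) : polytope V x) a → ⟨ a , x ⟩ ≈ S.sum (λ i → w i * ⟨ a , V i ⟩)
  inner-combination {x} (w , _ , _ , _ , Σwv≈x) a = begin
    S.sum (λ k → a k * x k)                            ≈⟨ S.sum-cong-≋ {3} (λ k → *-congˡ {a k} (Σwv≈x k)) ⟨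
    S.sum (λ k → a k * S.sum (λ i → w i * V i k))      ≈⟨ S.sum-cong-≋ {3} (λ k → S.*-distribˡ-sum (a k) (λ i → w i * V i k)) ⟩
    S.sum (λ k → S.sum (λ i → a k * (w i * V i k)))    ≈⟨ S.∑-comm {3} {n} (λ k i → a k * (w i * V i k)) ⟩
    S.sum (λ i → S.sum (λ k → a k * (w i * V i k)))    ≈⟨ S.sum-cong-≋ {n} (λ i → S.sum-cong-≋ {3} (λ k →
      solve 3 (λ a w v → a :* (w :* v) := w :* (a :* v)) refl (a k) (w i) (V i k))) ⟩
    S.sum (λ i → S.sum (λ k → w i * (a k * V i k)))    ≈⟨ S.sum-cong-≋ {n} (λ i → S.*-distribˡ-sum {3} (w i) (λ k → a k * V i k)) ⟨
    S.sum (λ i → w i * ⟨ a , V i ⟩)                    ∎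

  -- The value at `x` is a weighted mean of the values at the vertices. Positive gaps with weighted
  -- sum zero would force all weights to vanish, although they sum to 1.
  ¬all-below : ∀ {x} → polytope V x → ∀ a → ¬ (∀ i → ⟨ a , V i ⟩ < ⟨ a , x ⟩)
  ¬all-below {x} x∈P@(w , 0≤w , _ , Σw≈1 , _) a below = 1≢0 (trans (sym Σw≈1) (sum-zero w≈0))
    where
    gap : Fin n → Carrier
    gap i = ⟨ a , x ⟩ - ⟨ a , V i ⟩
    0<gap : ∀ i → 0# < gap i
    0<gap i = x<y⇒0<y-x (below i)
    Σgap≈0 : S.sum (λ i → w i * gap i) ≈ 0#
    Σgap≈0 = begin
      S.sum (λ i → w i * gap i)
        ≈⟨ S.sum-cong-≋ (λ i → solve 3 (λ w x v → w :* (x :- v) := w :* x :+ (:- (w :* v))) refl (w i) ⟨ a , x ⟩ ⟨ a , V i ⟩) ⟩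
      S.sum (λ i → w i * ⟨ a , x ⟩ - w i * ⟨ a , V i ⟩)
        ≈⟨ S.∑-distrib-+ (λ i → w i * ⟨ a , x ⟩) (λ i → - (w i * ⟨ a , V i ⟩)) ⟩
      S.sum (λ i → w i * ⟨ a , x ⟩) + S.sum (λ i → - (w i * ⟨ a , V i ⟩))
        ≈⟨ +-cong (sym (S.*-distribʳ-sum ⟨ a , x ⟩ w)) (sum-neg (λ i → w i * ⟨ a , V i ⟩)) ⟩
      S.sum w * ⟨ a , x ⟩ - S.sum (λ i → w i * ⟨ a , V i ⟩)
        ≈⟨ +-cong (trans (*-congʳ Σw≈1) (*-identityˡ _)) (-‿cong (sym (inner-combination x∈P a))) ⟩
      ⟨ a , x ⟩ - ⟨ a , x ⟩
        ≈⟨ -‿inverseʳ _ ⟩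
      0# ∎
      where
      sum-neg : ∀ {m} (t : Vector Carrier m) → S.sum (λ i → - t i) ≈ - S.sum t
      sum-neg {ℕ.zero}  t = sym -0#≈0#
      sum-neg {ℕ.suc m} t = trans (+-congˡ (sum-neg (t ∘ suc))) (-‿+-comm _ _)
    w≈0 : ∀ i → w i ≈ 0#
    w≈0 i = *-cancel-zero (0<gap i) (trans (*-comm _ _)
      (nonneg-sum-zero (λ i → nonneg*nonneg (0≤w i) (inj₁ (0<gap i))) Σgap≈0 i))

  inConvexPosition⇒areTheVertices : InConvexPosition → AreTheVertices V
  inConvexPosition⇒areTheVertices supports = injective , λ x → mk⇔ (vertex⇒V x) (λ (i , x≋Vᵢ) → V⇒vertex i x x≋Vᵢ)
    where
    f : Fin n → Form
    f i = separator planes ⊤ ⁅ i ⁆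

    f-V : ∀ i j → ⟦ f i ⟧ (V j) ≈ fromℤ (f i ∙ vertex p j)
    f-V i j = eval-embed (f i) (lookup p j)

    f-zero : ∀ i → ⟦ f i ⟧ (V i) ≈ 0#
    f-zero i = trans (f-V i i) (reflexive (≡.cong fromℤ (proj₁ (supports i))))

    injective : ∀ i j → V i ≋ V j → i ≡ j
    injective i j Vᵢ≋Vⱼ = decidable-stable (i Fin.≟ j) λ i≢j →
      irrefl (trans (sym (f-zero i)) (eval-cong (f i) (hom-cong Vᵢ≋Vⱼ)))
        (<-respʳ-≈ (sym (f-V i j)) (fromℤ-pos (proj₂ (supports i) j (i≢j ∘ ≡.sym))))

    vertex⇒V : ∀ x → IsVertex (polytope V) x → ∃ λ i → x ≋ V i
    -- If `x` were none of the listed points, `a` would be smaller at all of them than at `x`.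
    -- Equality in `K` is decidable, so the double negation can be removed.
    vertex⇒V x (x∈P , a , maximal) = decidable-stable (Fin.any? (λ i → Fin.all? (λ k → x k ≈? V i k))) λ x∉V →
      ¬all-below x∈P a (λ i → maximal (V i) (vertex∈conv ∈⊤) (λ Vᵢ≋x → x∉V (i , λ k → sym (Vᵢ≋x k))))

    V⇒vertex : ∀ i x → x ≋ V i → IsVertex (polytope V) x
    V⇒vertex i x x≋Vᵢ = conv-resp (λ k → sym (x≋Vᵢ k)) (vertex∈conv ∈⊤) , gradientVector (f i) , λ y y∈P y≄x →
      0<y-x⇒x<y (<-respʳ-≈ (sym (trans (gradientVector-difference (f i) x y)
          (trans (+-congˡ (trans (-‿cong fx≈0) -0#≈0#)) (+-identityʳ _))))
        ([ (λ 0<fy → 0<fy) , (λ 0≈fy → contradiction (λ k → trans (conv-singleton (y∈face y∈P (sym 0≈fy)) k) (sym (x≋Vᵢ k))) y≄x) ]′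
          (conv-nonneg p (f i) (λ j _ → nonneg j) y∈P)))
      where
      fx≈0 : ⟦ f i ⟧ x ≈ 0#
      fx≈0 = trans (eval-cong (f i) (hom-cong x≋Vᵢ)) (f-zero i)

      nonneg : ∀ j → 0ℤ ℤ.≤ f i ∙ vertex p j
      nonneg j = [ (λ { ≡.refl → ℤ.≤-reflexive (≡.sym (proj₁ (supports i))) }) , (λ j≢i → ℤ.<⇒≤ (proj₂ (supports i) j j≢i)) ]′
        (toSum (j Fin.≟ i))

      y∈face : ∀ {y} → polytope V y → ⟦ f i ⟧ y ≈ 0# → conv V ⁅ i ⁆ y
      y∈face y∈P fy≈0 = conv-face p (f i) (λ j _ → nonneg j)
        (λ j _ fⱼ≡0 → [ (λ { ≡.refl → x∈⁅x⁆ i }) , (λ j≢i → contradiction (≡.sym fⱼ≡0) (ℤ.<⇒≢ (proj₂ (supports i) j j≢i))) ]′ (toSum (j Fin.≟ i)))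
        fy≈0 y∈P

  polytope-nonneg : ∀ f z → (∀ i → 0ℤ ℤ.≤ f ∙ vertex p i) → polytope V (embed z) → 0ℤ ℤ.≤ f ∙ homogenise z
  polytope-nonneg f z 0≤f z∈P = fromℤ-reflects-nonneg (≤-respʳ-≈ (eval-embed f z) (conv-nonneg p f (λ i _ → 0≤f i) z∈P))

  excluded⇒∉polytope : ∀ z → Excluded z → ¬ polytope V (embed z)
  excluded⇒∉polytope z excluded z∈P =
    let f , 0≤f , fz<0 = Any.satisfied excluded in ℤ.<⇒≱ fz<0 (polytope-nonneg f z 0≤f z∈P)

  inBox-sound : ∀ lo m k → InBox lo m k → ∀ z → polytope V (embed z) → lookup z k ∈ₗ range lo m
  inBox-sound lo m k inBox z z∈P = ∈-range
    (ℤ.0≤i-j⇒j≤i (≡.subst (0ℤ ℤ.≤_) (≡.trans (coordinateForm-∙ (ℤ.- lo) (+ 1) k z) (lower lo (lookup z k)))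
      (polytope-nonneg (coordinateForm (ℤ.- lo) (+ 1) k) z (proj₁ ∘ inBox) z∈P)))
    (ℤ.0≤i-j⇒j≤i (≡.subst (0ℤ ℤ.≤_) (≡.trans (coordinateForm-∙ (lo ℤ.+ + m) (ℤ.- (+ 1)) k z) (upper (lo ℤ.+ + m) (lookup z k)))
      (polytope-nonneg (coordinateForm (lo ℤ.+ + m) (ℤ.- (+ 1)) k) z (proj₂ ∘ inBox) z∈P)))
    where
    lower : ∀ x y → ℤ.- x ℤ.+ + 1 ℤ.* y ≡ y ℤ.- x
    lower = solve-∀
    upper : ∀ x y → x ℤ.+ ℤ.- (+ 1) ℤ.* y ≡ x ℤ.- y
    upper = solve-∀

  emptyLattice-sound : ∀ lo m → EmptyLattice lo m → ∀ z → polytope V (embed z) ⇔ ∃ λ i → z ≡ lookup p i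
  emptyLattice-sound lo m (inBox , classified) z@(x₁ ∷ x₂ ∷ x₃ ∷ []) = mk⇔
    (λ z∈P → [ (λ z≡p → z≡p) , (λ excluded → contradiction z∈P (excluded⇒∉polytope z excluded)) ]′
      (All.lookup (All.lookup (All.lookup classified (bounded 0F z∈P)) (bounded 1F z∈P)) (bounded 2F z∈P)))
    (λ (i , z≡pᵢ) → ≡.subst (λ z → polytope V (embed z)) (≡.sym z≡pᵢ) (vertex∈conv ∈⊤))
    where
    bounded : ∀ k → polytope V (embed z) → lookup z k ∈ₗ range (lookup lo k) (lookup m k)
    bounded k = inBox-sound (lookup lo k) (lookup m k) k (inBox k) z

  module WeighingTheorem {N : Subset n → Fin n → Form} {k : ℤ} {samples : List (ℤ × Homogeneous)}
                         {dependences : List (Vec ℤ n)} {D₀ : Simplices n} (weighs : Weighing.Weighs p N k samples dependences D₀)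
                         (dissection₀ : IsDissection V D₀) where
    open Weighing p N k samples

    private
      located     = proj₁ weighs
      hit         = proj₁ (proj₂ weighs)
      total       = proj₁ (proj₂ (proj₂ weighs))
      classified  = proj₂ (proj₂ (proj₂ weighs))

    balanced : ∀ {T} → IsTetrahedron V T → Balanced D₀ (N T) T
    balanced {T} (∣T∣≡4 , independent) =
      [ (λ dependent → contradiction independent (uncurry (dependence⇒¬independent T) (Any.satisfied dependent))) ,
        (λ balanced → balanced) ]′ (classified T ∣T∣≡4)

    module _ {D} (dissection : IsDissection V D) where
      private
        unique     = proj₁ dissection
        tetrahedra = proj₁ (proj₂ dissection)
        covering   = proj₂ (proj₂ (proj₂ dissection))

      same-piece : ∀ {y s T T′} → (y , s) ∈ₗ samples → T ∈ₗ D → T′ ∈ₗ D →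
                   Inside (N T) T s → Inside (N T′) T′ s → T ≡ T′
      same-piece {y} {s} {T} {T′} s∈ T∈D T′∈D inT inT′ =
        overlap⇒≡ dissection T∈D T′∈D (dehomogenise (fraction s 0<d))
          (inside⇒interior {T} {N T} (proj₁ (balanced (All.lookup tetrahedra T∈D))) s 0<d inT)
          (inside⇒interior {T′} {N T′} (proj₁ (balanced (All.lookup tetrahedra T′∈D))) s 0<d inT′)
        where
        0<d : 0ℤ ℤ.< lookup s 0F
        0<d = proj₁ (All.lookup located s∈)

      -- The sample lies inside a piece of `D₀`, hence in the polytope, hence in some `T` of `D`.
      -- Since it is strictly inside or strictly outside `T`, it is strictly inside.
      some-piece : ∀ {y s} → (y , s) ∈ₗ samples → ∃ λ T → T ∈ₗ D × Inside (N T) T s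
      some-piece {y} {s} s∈ = from-located (All.lookup located s∈)
        where
        from-located : 0ℤ ℤ.< lookup s 0F × Any (λ T → Inside (N T) T s) D₀ → ∃ λ T → T ∈ₗ D × Inside (N T) T s
        from-located (0<d , inD₀) = from-piece₀ (find inD₀)
          where
          x : Point
          x = dehomogenise (fraction s 0<d)

          from-piece : (∃ λ T → T ∈ₗ D × conv V T x) → ∃ λ T → T ∈ₗ D × Inside (N T) T s
          from-piece (T , T∈D , x∈T) = from-balanced (balanced (All.lookup tetrahedra T∈D))
            where
            from-balanced : Balanced D₀ (N T) T → ∃ λ T → T ∈ₗ D × Inside (N T) T s
            from-balanced (bary , sides , _) = T , T∈D ,
              [ (λ inT → inT) , (λ out → contradiction x∈T (outside⇒∉conv {T} {N T} bary s 0<d out)) ]′ (All.lookup sides s∈)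

          from-piece₀ : (∃ λ T₀ → T₀ ∈ₗ D₀ × Inside (N T₀) T₀ s) → ∃ λ T → T ∈ₗ D × Inside (N T) T s
          from-piece₀ (T₀ , T₀∈D₀ , inT₀) = from-piece (find (Equivalence.to (covering x) (conv-mono p {T₀} (λ _ → ∈⊤)
            (Interior-point {S = conv V T₀} {x} (inside⇒interior {T₀} {N T₀}
              (proj₁ (balanced (All.lookup (proj₁ (proj₂ dissection₀)) T₀∈D₀))) s 0<d inT₀)))))

      k≤weight : ∀ {T} → T ∈ₗ D → k ℤ.≤ weight (N T) T
      k≤weight T∈D = [ ℤ.<⇒≤ , ℤ.≤-reflexive ∘ proj₁ ]′ (proj₂ (proj₂ (balanced (All.lookup tetrahedra T∈D))))

      sample-weight : ∀ {y s} → (y , s) ∈ₗ samples →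
                      ∑ (λ T → if does (inside? (N T) T s) then y else 0ℤ) D ≡ y
      sample-weight {y} {s} s∈ =
        let T , T∈D , inT = some-piece s∈
        in ∑-indicator (λ T → does (inside? (N T) T s)) y unique
          (λ {T₁} {T₂} T₁∈D T₂∈D b₁ b₂ → same-piece {y} {s} {T₁} {T₂} s∈ T₁∈D T₂∈D
            (does-true (inside? (N T₁) T₁ s) b₁) (does-true (inside? (N T₂) T₂ s) b₂))
          {T} T∈D (dec-true (inside? (N T) T s) inT)

      -- Double counting: after exchanging the sums, each sample contributes its weight exactly
      -- once.
      total-weight : ∑ (λ T → weight (N T) T) D ≡ k ℤ.* + length D₀
      total-weight = ≡.trans (∑-swap (λ T (y , s) → if does (inside? (N T) T s) then y else 0ℤ) D samples)
        (≡.trans (∑-cong samples sample-weight) total)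

      size-bound : k ℤ.* + length D ℤ.≤ k ℤ.* + length D₀
      size-bound = ≡.subst₂ ℤ._≤_ (∑-const k D) total-weight (∑-mono-≤ D k≤weight)

      -- Without slack in the total every piece weighs exactly `k`, and only members of `D₀` may do
      -- so.
      extremal⊆ : k ℤ.* + length D₀ ℤ.≤ k ℤ.* + length D → ∀ {T} → T ∈ₗ D → T ∈ₗ D₀
      extremal⊆ kD₀≤kD {T} T∈D =
        [ (λ k<w → contradiction (∑-tight D k≤weight Σweight≤Σk T∈D) (ℤ.<⇒≱ k<w)) , proj₂ ]′
        (proj₂ (proj₂ (balanced (All.lookup tetrahedra T∈D))))
        where
        Σweight≤Σk : ∑ (λ T → weight (N T) T) D ℤ.≤ ∑ (const k) D
        Σweight≤Σk = ≡.subst₂ ℤ._≤_ (≡.sym total-weight) (≡.sym (∑-const k D)) kD₀≤kD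

    -- For the reverse inclusion, a sample inside `T` lies in some piece `T′` of `D`, already known
    -- to belong to `D₀`; two pieces of `D₀` with a common interior point coincide.
    unique-extremal : ∀ {D} → IsDissection V D → k ℤ.* + length D₀ ℤ.≤ k ℤ.* + length D → D ∼[ set ] D₀
    unique-extremal {D} dissection kD₀≤kD = mk⇔ (extremal⊆ dissection kD₀≤kD) ⊇
      where
      ⊇ : ∀ {T} → T ∈ₗ D₀ → T ∈ₗ D
      ⊇ {T} T∈D₀ = from-sample (find (All.lookup hit T∈D₀))
        where
        from-sample : (∃ λ ys → ys ∈ₗ samples × Inside (N T) T (proj₂ ys)) → T ∈ₗ D
        from-sample ((y , s) , s∈ , inT) = from-piece (some-piece dissection s∈)
          where
          from-piece : (∃ λ T′ → T′ ∈ₗ D × Inside (N T′) T′ s) → T ∈ₗ D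
          from-piece (T′ , T′∈D , inT′) = ≡.subst (_∈ₗ D)
            (≡.sym (same-piece dissection₀ {y} {s} {T} {T′} s∈ T∈D₀ (extremal⊆ dissection kD₀≤kD T′∈D) inT inT′)) T′∈D

tetra : ∀ {n} → Fin n → Fin n → Fin n → Fin n → Subset n
tetra a b c d = ⁅ a ⁆ ∪ ⁅ b ⁆ ∪ ⁅ c ⁆ ∪ ⁅ d ⁆

-- Extremal sizes of dissections and triangulations

module Extremal
  {n} (p : LatticePoints n) {c ℓ₁ ℓ₂} (K : OrderedField c ℓ₁ ℓ₂)
  {_⊑_ : ℕ → ℕ → Set} (⊑-antisym : ∀ {a b} → a ⊑ b → b ⊑ a → a ≡ b)
  {k : ℤ} (⊑-cancel : ∀ {a b} → k ℤ.* + a ℤ.≤ k ℤ.* + b → a ⊑ b) (⊑-mono : ∀ {a b} → a ⊑ b → k ℤ.* + a ℤ.≤ k ℤ.* + b)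
  where
  open Geometry K
  open Check p
  open Soundness p K

  -- Maximal for _⊑_ = _≤_ and Minimal for _⊑_ = _≥_.
  Extreme : (Simplices n → Set (c ⊔ ℓ₁ ⊔ ℓ₂)) → Simplices n → Set (c ⊔ ℓ₁ ⊔ ℓ₂)
  Extreme Q D = Q D × (∀ D′ → Q D′ → length D′ ⊑ length D)

  module _ {samples : List (ℤ × Homogeneous)} {dependences : List (Vec ℤ n)} {D₀ : Simplices n} {t : Cover} (dissects : Dissects D₀ t)
           (weighs : Weighing.Weighs p coordinates k samples dependences D₀) where
    private
      dissection₀ : IsDissection V D₀
      dissection₀ = dissects⇒isDissection {D₀} {t} dissects

    open WeighingTheorem {coordinates} {k} {samples} {dependences} {D₀} weighs dissection₀

    bound : ∀ D → IsDissection V D → length D ⊑ length D₀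
    bound D dissection = ⊑-cancel (size-bound dissection)

    theExtremeDissection : TheUnique (Extreme (IsDissection V)) D₀
    theExtremeDissection = (dissection₀ , bound) , λ D (dissection , extreme) →
      unique-extremal dissection (⊑-mono (extreme D₀ dissection₀))

    module _ {T T′ : Subset n} {s : Homogeneous} (T∈D₀ : T ∈ₗ D₀) (T′∈D₀ : T′ ∈ₗ D₀) (crosses : Crosses (coordinates T) (coordinates T′) T T′ s)
             {m : ℕ} (next : ∀ {a} → a ⊑ length D₀ → ¬ (length D₀ ⊑ a) → a ⊑ m) where

      -- A triangulation as extreme as `D₀` would have the same pieces, among them `T` and `T′`,
      -- which cross. So its size differs, and `next` names `m` as the nearest size left.
      triangulation-bound : ∀ D → IsTriangulation V D → length D ⊑ m
      triangulation-bound D (dissection , meet) = next (bound D dissection) λ D₀⊑D →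
        let D∼D₀ = unique-extremal dissection (⊑-mono D₀⊑D) in
        crosses⇒¬meet (coordinates T) (coordinates T′) T T′ s crosses
          (meet (Equivalence.from D∼D₀ T∈D₀) (Equivalence.from D∼D₀ T′∈D₀))

      extremeTriangulation : ∀ {D} → IsTriangulation V D → length D ≡ m → Extreme (IsTriangulation V) D
      extremeTriangulation triangulation ∣D∣≡m = triangulation , λ D′ triangulation′ →
        ≡.subst (length D′ ⊑_) (≡.sym ∣D∣≡m) (triangulation-bound D′ triangulation′)

      extremeTriangulation-size : ∀ {D₁} → IsTriangulation V D₁ → length D₁ ≡ m →
                                  ∀ D → Extreme (IsTriangulation V) D → length D ≡ m
      extremeTriangulation-size {D₁} triangulation₁ ∣D₁∣≡m D (triangulation , extreme) =
        ⊑-antisym (triangulation-bound D triangulation) (≡.subst (_⊑ length D) ∣D₁∣≡m (extreme D₁ triangulation₁))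

different : ∀ {n} {D D′ : Simplices n} → Any (_∉ₗ D′) D → ¬ (D ∼[ set ] D′)
different D⊈D′ D∼D′ = let _ , T∈D , T∉D′ = find D⊈D′ in T∉D′ (Equivalence.to D∼D′ T∈D)

different? : ∀ {n} (D D′ : Simplices n) → Dec (Any (_∉ₗ D′) D)
different? D D′ = Any.any? (λ T → ¬? (T ∈ₗ? D′)) D

isUnimodular? : ∀ {n} (p : LatticePoints n) T → Dec (IsUnimodular p T)
isUnimodular? p T = Fin.any? λ a → Fin.any? λ b → Fin.any? λ c → Fin.any? λ d →
  T ≟ₛ (tetra a b c d) ×-dec volume (lookup p a) (lookup p b) (lookup p c) (lookup p d) ℚ.≟ (+ 1) ℚ./ 6

-- The two polytopes

module Literals where
  open import Agda.Builtin.FromNat public using (Number; fromNat)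
  open import Agda.Builtin.FromNeg public using (Negative; fromNeg)
  open import Data.Unit.Base public using (tt)
  import Data.Integer.Literals as ℤ-literals
  import Data.Nat.Literals as ℕ-literals

  instance
    ℕ-number : Number ℕ
    ℕ-number = ℕ-literals.number

    ℤ-number : Number ℤ
    ℤ-number = ℤ-literals.number

    ℤ-negative : Negative ℤ
    ℤ-negative = ℤ-literals.negative

module Polytope₁ where
  open Literals
  open Check points₁

  s e w n v₁ v₂ u₁ u₂ : Fin 8
  s  = 0F
  e  = 1F
  w  = 2F
  n  = 3F
  v₁ = 4F
  v₂ = 5F
  u₁ = 6F
  u₂ = 7F

  -- The affine dependences of the coplanar quadruples of vertices.
  dependences : List (Vec ℤ 8)
  dependences =
    (1 ∷ -1 ∷ -1 ∷ 1 ∷ 0 ∷ 0 ∷ 0 ∷ 0 ∷ []) ∷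
    (1 ∷ 1 ∷ 0 ∷ 0 ∷ -1 ∷ 0 ∷ 0 ∷ -1 ∷ []) ∷
    (0 ∷ 0 ∷ 1 ∷ 1 ∷ 0 ∷ -1 ∷ -1 ∷ 0 ∷ []) ∷
    []

  -- Above the square the pieces use the diagonal `s n`, below it the diagonal `e w`.
  largest : Simplices 8
  largest =
    tetra s e w u₁ ∷
    tetra s e n v₂ ∷
    tetra s e v₁ v₂ ∷
    tetra s e u₁ u₂ ∷
    tetra s w n v₁ ∷
    tetra s w v₁ u₁ ∷
    tetra s n v₁ v₂ ∷
    tetra e w n u₂ ∷
    tetra e w u₁ u₂ ∷
    tetra e n v₂ u₂ ∷
    tetra w n v₁ v₂ ∷
    tetra w n u₁ u₂ ∷
    []

  largest-cover : Cover
  largest-cover =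
    cut s e w
      (cut s w v₁
        (cut e v₂ n
          (cut s v₂ v₁
            (cut s v₂ e
              (piece (tetra s e n v₂))
              (piece (tetra s e v₁ v₂)))
            (cut s n v₂
              (piece (tetra s e n v₂))
              (cut s n v₁
                (cut n v₂ v₁
                  (piece (tetra s n v₁ v₂))
                  (piece (tetra w n v₁ v₂)))
                (cut w n v₁
                  (piece (tetra s w n v₁))
                  (piece (tetra w n v₁ v₂))))))
          (piece (tetra e n v₂ u₂)))
        (piece (tetra s w v₁ u₁)))
      (cut s u₁ w
        (cut e n u₂
          (cut e u₁ u₂
            (cut s e u₁
              (piece (tetra s e w u₁))
              (piece (tetra s e u₁ u₂)))
            (cut e w u₁
              (piece (tetra s e w u₁))
              (cut e w u₂
                (cut w u₁ u₂
                  (piece (tetra e w u₁ u₂))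
                  (piece (tetra w n u₁ u₂)))
                (cut w u₂ n
                  (piece (tetra e w n u₂))
                  (piece (tetra w n u₁ u₂))))))
          (piece (tetra e n v₂ u₂)))
        (piece (tetra s w v₁ u₁)))

  -- Here both sides of the square use the diagonal `e w`; in `triangulation₂` both use `s n`.
  triangulation₁ : Simplices 8
  triangulation₁ =
    tetra s e w v₂ ∷
    tetra s e w u₁ ∷
    tetra s e v₁ v₂ ∷
    tetra s e u₁ u₂ ∷
    tetra s w v₁ v₂ ∷
    tetra s w v₁ u₁ ∷
    tetra e w n v₂ ∷
    tetra e w n u₂ ∷
    tetra e w u₁ u₂ ∷
    tetra e n v₂ u₂ ∷
    tetra w n u₁ u₂ ∷
    []

  triangulation₁-cover : Cover
  triangulation₁-cover =
    cut s e w
      (cut e v₂ w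
        (cut s w v₁
          (cut s v₂ e
            (cut s w v₂
              (piece (tetra s e w v₂))
              (piece (tetra s w v₁ v₂)))
            (cut s v₂ v₁
              (piece (tetra s e v₁ v₂))
              (piece (tetra s w v₁ v₂))))
          (piece (tetra s w v₁ u₁)))
        (cut e v₂ n
          (piece (tetra e w n v₂))
          (piece (tetra e n v₂ u₂))))
      (cut s u₁ w
        (cut e n u₂
          (cut e u₁ u₂
            (cut s e u₁
              (piece (tetra s e w u₁))
              (piece (tetra s e u₁ u₂)))
            (cut e w u₁
              (piece (tetra s e w u₁))
              (cut e w u₂
                (cut w u₁ u₂
                  (piece (tetra e w u₁ u₂))
                  (piece (tetra w n u₁ u₂)))
                (cut w u₂ n
                  (piece (tetra e w n u₂))
                  (piece (tetra w n u₁ u₂))))))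
          (piece (tetra e n v₂ u₂)))
        (piece (tetra s w v₁ u₁)))

  triangulation₂ : Simplices 8
  triangulation₂ =
    tetra s e n v₂ ∷
    tetra s e n u₁ ∷
    tetra s e v₁ v₂ ∷
    tetra s e u₁ u₂ ∷
    tetra s w n v₁ ∷
    tetra s w n u₁ ∷
    tetra s w v₁ u₁ ∷
    tetra s n v₁ v₂ ∷
    tetra e n v₂ u₂ ∷
    tetra e n u₁ u₂ ∷
    tetra w n v₁ v₂ ∷
    []

  triangulation₂-cover : Cover
  triangulation₂-cover =
    cut s e w
      (cut s w v₁
        (cut e v₂ n
          (cut s v₂ v₁
            (cut s v₂ e
              (piece (tetra s e n v₂))
              (piece (tetra s e v₁ v₂)))
            (cut s n v₂
              (piece (tetra s e n v₂))
              (cut s n v₁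
                (cut n v₂ v₁
                  (piece (tetra s n v₁ v₂))
                  (piece (tetra w n v₁ v₂)))
                (cut w n v₁
                  (piece (tetra s w n v₁))
                  (piece (tetra w n v₁ v₂))))))
          (piece (tetra e n v₂ u₂)))
        (piece (tetra s w v₁ u₁)))
      (cut s u₁ n
        (cut e n u₂
          (cut s e u₁
            (cut e n u₁
              (piece (tetra s e n u₁))
              (piece (tetra e n u₁ u₂)))
            (cut e u₁ u₂
              (piece (tetra s e u₁ u₂))
              (piece (tetra e n u₁ u₂))))
          (piece (tetra e n v₂ u₂)))
        (cut s u₁ w
          (piece (tetra s w n u₁))
          (piece (tetra s w v₁ u₁))))

  -- A common denominator: divided by 6, the weights below give every tetrahedron at least 1 and add
  -- up to 12.
  largest-unit : ℤ
  largest-unit = 6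

  -- (y , d ∷ a ∷ b ∷ c ∷ []) is the point (a, b, c)/d with weight y; the weights
  -- come from an optimal solution of the dual linear program.
  largest-samples : List (ℤ × Homogeneous)
  largest-samples =
    (6 , 4 ∷ -1 ∷ 2 ∷ 0 ∷ []) ∷
    (5 , 5 ∷ 1 ∷ 4 ∷ 2 ∷ []) ∷
    (6 , 8 ∷ 6 ∷ 1 ∷ -2 ∷ []) ∷
    (2 , 9 ∷ 5 ∷ 6 ∷ -3 ∷ []) ∷
    (4 , 9 ∷ 6 ∷ 7 ∷ 2 ∷ []) ∷
    (2 , 9 ∷ 7 ∷ 3 ∷ -3 ∷ []) ∷
    (2 , 9 ∷ 8 ∷ 7 ∷ 1 ∷ []) ∷
    (6 , 9 ∷ 10 ∷ 3 ∷ 1 ∷ []) ∷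
    (2 , 10 ∷ 4 ∷ 5 ∷ 2 ∷ []) ∷
    (1 , 10 ∷ 5 ∷ 8 ∷ 4 ∷ []) ∷
    (1 , 11 ∷ -3 ∷ 5 ∷ 5 ∷ []) ∷
    (3 , 12 ∷ 2 ∷ 10 ∷ 1 ∷ []) ∷
    (2 , 12 ∷ 6 ∷ 3 ∷ 2 ∷ []) ∷
    (2 , 13 ∷ 13 ∷ 2 ∷ -3 ∷ []) ∷
    (6 , 16 ∷ 2 ∷ 8 ∷ -7 ∷ []) ∷
    (6 , 17 ∷ 6 ∷ 15 ∷ -1 ∷ []) ∷
    (2 , 21 ∷ 0 ∷ 3 ∷ 2 ∷ []) ∷
    (4 , 21 ∷ 10 ∷ 19 ∷ -12 ∷ []) ∷
    (2 , 22 ∷ 21 ∷ 19 ∷ 2 ∷ []) ∷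
    (4 , 37 ∷ 6 ∷ 3 ∷ 10 ∷ []) ∷
    (2 , 37 ∷ 22 ∷ 3 ∷ 5 ∷ []) ∷
    (2 , 41 ∷ 27 ∷ 38 ∷ -10 ∷ []) ∷
    []

module Polytope₂ where
  open Literals
  open Check points₂

  u₁ w v₁ s v₂ n u₂ e : Fin 8
  u₁ = 0F
  w  = 1F
  v₁ = 2F
  s  = 3F
  v₂ = 4F
  n  = 5F
  u₂ = 6F
  e  = 7F

  -- One for each of the seven coplanar quadruples of vertices; the other 63 of the 70 quadruples
  -- span tetrahedra.
  dependences : List (Vec ℤ 8)
  dependences =
    (1 ∷ -1 ∷ 1 ∷ -1 ∷ 0 ∷ 0 ∷ 0 ∷ 0 ∷ []) ∷
    (2 ∷ -2 ∷ 0 ∷ 0 ∷ 1 ∷ 0 ∷ -1 ∷ 0 ∷ []) ∷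
    (1 ∷ 0 ∷ -1 ∷ 0 ∷ 2 ∷ -2 ∷ 0 ∷ 0 ∷ []) ∷
    (1 ∷ 0 ∷ -1 ∷ 0 ∷ 0 ∷ 0 ∷ -2 ∷ 2 ∷ []) ∷
    (0 ∷ 1 ∷ 0 ∷ -1 ∷ 0 ∷ -1 ∷ 0 ∷ 1 ∷ []) ∷
    (0 ∷ 0 ∷ 2 ∷ -2 ∷ -1 ∷ 0 ∷ 1 ∷ 0 ∷ []) ∷
    (0 ∷ 0 ∷ 0 ∷ 0 ∷ 1 ∷ -1 ∷ 1 ∷ -1 ∷ []) ∷
    []

  -- The plane x = z through `w`, `s`, `e`, `n` separates five pieces on the side of `u₁`, `u₂`,
  -- which use the diagonal `w e`, from five on the side of `v₁`, `v₂`, which use `s n`.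
  largest : Simplices 8
  largest =
    tetra u₁ w s e ∷
    tetra u₁ w n u₂ ∷
    tetra u₁ w u₂ e ∷
    tetra u₁ s u₂ e ∷
    tetra w v₁ s n ∷
    tetra w v₁ v₂ n ∷
    tetra w n u₂ e ∷
    tetra v₁ s v₂ n ∷
    tetra v₁ s v₂ e ∷
    tetra s v₂ n e ∷
    []

  largest-cover : Cover
  largest-cover =
    cut w s n
      (cut u₁ u₂ e
        (cut u₁ w e
          (piece (tetra u₁ w s e))
          (cut w n u₂
            (cut w e u₂
              (piece (tetra u₁ w u₂ e))
              (piece (tetra w n u₂ e)))
            (cut u₁ w v₂
              (piece (tetra u₁ w u₂ e))
              (piece (tetra u₁ w n u₂)))))
        (cut u₁ e s
          (piece (tetra u₁ w s e))
          (piece (tetra u₁ s u₂ e))))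
      (cut u₁ v₂ n
        (cut v₁ s n
          (piece (tetra w v₁ s n))
          (cut s n v₂
            (cut v₁ s v₂
              (piece (tetra v₁ s v₂ n))
              (piece (tetra v₁ s v₂ e)))
            (cut s e v₂
              (piece (tetra s v₂ n e))
              (piece (tetra v₁ s v₂ e)))))
        (cut w v₁ n
          (piece (tetra w v₁ s n))
          (piece (tetra w v₁ v₂ n))))

  -- With the diagonals exchanged, `s n` towards `u₁`, `u₂` and `w e` towards `v₁`, `v₂`, each half
  -- needs only three pieces.
  smallest : Simplices 8
  smallest =
    tetra u₁ w s n ∷
    tetra u₁ s n u₂ ∷
    tetra w v₁ s e ∷
    tetra w v₁ v₂ e ∷
    tetra w v₂ n e ∷
    tetra s n u₂ e ∷
    []

  smallest-cover : Cover
  smallest-cover =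
    cut w s n
      (cut u₁ n s
        (piece (tetra u₁ w s n))
        (cut s u₂ n
          (piece (tetra u₁ s n u₂))
          (piece (tetra s n u₂ e))))
      (cut w v₂ e
        (cut w v₁ e
          (piece (tetra w v₁ s e))
          (piece (tetra w v₁ v₂ e)))
        (piece (tetra w v₂ n e)))

  -- The half containing `u₁`, `u₂` is cut as in `largest`; the other half now also uses `w e`,
  -- which costs one piece.
  largeTriangulation₁ : Simplices 8
  largeTriangulation₁ =
    tetra u₁ w s e ∷
    tetra u₁ w n u₂ ∷
    tetra u₁ w u₂ e ∷
    tetra u₁ s u₂ e ∷
    tetra w v₁ s v₂ ∷
    tetra w s v₂ e ∷
    tetra w v₂ n e ∷
    tetra w n u₂ e ∷
    tetra v₁ s v₂ e ∷
    []

  largeTriangulation₁-cover : Cover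
  largeTriangulation₁-cover =
    cut w s n
      (cut u₁ u₂ e
        (cut u₁ w e
          (piece (tetra u₁ w s e))
          (cut w n u₂
            (cut w e u₂
              (piece (tetra u₁ w u₂ e))
              (piece (tetra w n u₂ e)))
            (cut u₁ w v₂
              (piece (tetra u₁ w u₂ e))
              (piece (tetra u₁ w n u₂)))))
        (cut u₁ e s
          (piece (tetra u₁ w s e))
          (piece (tetra u₁ s u₂ e))))
      (cut w v₂ e
        (cut w s v₂
          (cut s e v₂
            (piece (tetra w s v₂ e))
            (piece (tetra v₁ s v₂ e)))
          (cut v₁ s v₂
            (piece (tetra w v₁ s v₂))
            (piece (tetra v₁ s v₂ e))))
        (piece (tetra w v₂ n e)))

  largeTriangulation₂ : Simplices 8
  largeTriangulation₂ =
    tetra u₁ w s u₂ ∷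
    tetra u₁ w n u₂ ∷
    tetra w v₁ s n ∷
    tetra w v₁ v₂ n ∷
    tetra w s n u₂ ∷
    tetra v₁ s v₂ n ∷
    tetra v₁ s v₂ e ∷
    tetra s v₂ n u₂ ∷
    tetra s v₂ u₂ e ∷
    []

  largeTriangulation₂-cover : Cover
  largeTriangulation₂-cover =
    cut v₁ s v₂
      (cut w s n
        (cut s u₂ n
          (cut w s u₂
            (cut u₁ w v₂
              (piece (tetra u₁ w s u₂))
              (piece (tetra u₁ w n u₂)))
            (cut w n u₂
              (piece (tetra w s n u₂))
              (piece (tetra u₁ w n u₂))))
          (piece (tetra s v₂ n u₂)))
        (cut s n v₂
          (cut u₁ v₂ n
            (cut v₁ s n
              (piece (tetra w v₁ s n))
              (piece (tetra v₁ s v₂ n)))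
            (cut w v₁ n
              (piece (tetra w v₁ s n))
              (piece (tetra w v₁ v₂ n))))
          (piece (tetra s v₂ n u₂))))
      (cut s e v₂
        (piece (tetra s v₂ u₂ e))
        (piece (tetra v₁ s v₂ e)))

  -- Every piece contains `v₂`: this is the cone from `v₂` over triangulated facets that avoid it.
  -- Neither diagonal of the parallelogram occurs.
  smallTriangulation₁ : Simplices 8
  smallTriangulation₁ =
    tetra u₁ w s v₂ ∷
    tetra u₁ w v₂ n ∷
    tetra u₁ s v₂ u₂ ∷
    tetra u₁ v₂ n u₂ ∷
    tetra w v₁ s v₂ ∷
    tetra v₁ s v₂ e ∷
    tetra s v₂ u₂ e ∷
    []

  smallTriangulation₁-cover : Cover
  smallTriangulation₁-cover =
    cut u₁ w v₂
      (cut v₁ s v₂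
        (cut w s v₂
          (cut u₁ v₂ s
            (piece (tetra u₁ w s v₂))
            (piece (tetra u₁ s v₂ u₂)))
          (piece (tetra w v₁ s v₂)))
        (cut s e v₂
          (piece (tetra s v₂ u₂ e))
          (piece (tetra v₁ s v₂ e))))
      (cut u₁ v₂ n
        (piece (tetra u₁ v₂ n u₂))
        (piece (tetra u₁ w v₂ n)))

  smallTriangulation₂ : Simplices 8
  smallTriangulation₂ =
    tetra u₁ w s u₂ ∷
    tetra u₁ w n u₂ ∷
    tetra w v₁ s v₂ ∷
    tetra w s v₂ u₂ ∷
    tetra w v₂ n u₂ ∷
    tetra v₁ s v₂ e ∷
    tetra s v₂ u₂ e ∷
    []

  smallTriangulation₂-cover : Cover
  smallTriangulation₂-cover =
    cut u₁ w v₂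
      (cut v₁ s v₂
        (cut w s u₂
          (piece (tetra u₁ w s u₂))
          (cut w s v₂
            (piece (tetra w s v₂ u₂))
            (piece (tetra w v₁ s v₂))))
        (cut s e v₂
          (piece (tetra s v₂ u₂ e))
          (piece (tetra v₁ s v₂ e))))
      (cut w n u₂
        (piece (tetra w v₂ n u₂))
        (piece (tetra u₁ w n u₂)))

  largest-unit : ℤ
  largest-unit = 6

  largest-samples : List (ℤ × Homogeneous)
  largest-samples =
    (4 , 5 ∷ 0 ∷ 2 ∷ 3 ∷ []) ∷
    (1 , 6 ∷ -2 ∷ 1 ∷ 0 ∷ []) ∷
    (3 , 6 ∷ -1 ∷ 2 ∷ 0 ∷ []) ∷
    (1 , 7 ∷ -2 ∷ 6 ∷ -4 ∷ []) ∷
    (2 , 7 ∷ -1 ∷ 5 ∷ -4 ∷ []) ∷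
    (5 , 7 ∷ 1 ∷ 5 ∷ 4 ∷ []) ∷
    (4 , 7 ∷ 2 ∷ 4 ∷ -3 ∷ []) ∷
    (1 , 7 ∷ 4 ∷ 4 ∷ 3 ∷ []) ∷
    (4 , 8 ∷ -6 ∷ 3 ∷ -5 ∷ []) ∷
    (1 , 8 ∷ -5 ∷ 2 ∷ -1 ∷ []) ∷
    (1 , 8 ∷ -3 ∷ 2 ∷ 0 ∷ []) ∷
    (1 , 8 ∷ 0 ∷ 1 ∷ -2 ∷ []) ∷
    (1 , 8 ∷ 3 ∷ 2 ∷ 0 ∷ []) ∷
    (2 , 9 ∷ 2 ∷ 8 ∷ 5 ∷ []) ∷
    (6 , 10 ∷ -3 ∷ 5 ∷ -7 ∷ []) ∷
    (2 , 10 ∷ 3 ∷ 6 ∷ 7 ∷ []) ∷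
    (4 , 10 ∷ 4 ∷ 8 ∷ 3 ∷ []) ∷
    (1 , 10 ∷ 7 ∷ 1 ∷ 5 ∷ []) ∷
    (6 , 11 ∷ -7 ∷ 5 ∷ -2 ∷ []) ∷
    (6 , 11 ∷ 10 ∷ 6 ∷ 7 ∷ []) ∷
    (3 , 12 ∷ -6 ∷ 7 ∷ -8 ∷ []) ∷
    (1 , 12 ∷ 6 ∷ 7 ∷ 8 ∷ []) ∷
    []

  -- Negative, so that the bound k |D| ≤ k |D₀| is a lower bound for |D|.
  smallest-unit : ℤ
  smallest-unit = -7

  -- Both signs occur: that each sample is covered exactly once is an equation, so its dual variable
  -- is unrestricted in sign.
  smallest-samples : List (ℤ × Homogeneous)
  smallest-samples =
    (-4 , 5 ∷ 0 ∷ 2 ∷ 3 ∷ []) ∷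
    (3 , 6 ∷ -3 ∷ 4 ∷ -2 ∷ []) ∷
    (-2 , 6 ∷ -2 ∷ 1 ∷ 0 ∷ []) ∷
    (-4 , 7 ∷ -2 ∷ 2 ∷ -1 ∷ []) ∷
    (-5 , 7 ∷ -2 ∷ 6 ∷ -4 ∷ []) ∷
    (-1 , 7 ∷ 2 ∷ 4 ∷ -3 ∷ []) ∷
    (1 , 7 ∷ 2 ∷ 4 ∷ 3 ∷ []) ∷
    (-1 , 8 ∷ 3 ∷ 2 ∷ 0 ∷ []) ∷
    (2 , 9 ∷ -4 ∷ 6 ∷ -5 ∷ []) ∷
    (-6 , 9 ∷ 3 ∷ 7 ∷ 4 ∷ []) ∷
    (-1 , 10 ∷ -3 ∷ 4 ∷ -1 ∷ []) ∷
    (-2 , 10 ∷ -3 ∷ 5 ∷ -7 ∷ []) ∷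
    (-2 , 10 ∷ 3 ∷ 6 ∷ 7 ∷ []) ∷
    (2 , 11 ∷ -3 ∷ 5 ∷ -4 ∷ []) ∷
    (-6 , 11 ∷ 10 ∷ 6 ∷ 7 ∷ []) ∷
    (-6 , 12 ∷ -7 ∷ 6 ∷ 0 ∷ []) ∷
    (-6 , 12 ∷ -6 ∷ 7 ∷ -8 ∷ []) ∷
    (-4 , 12 ∷ -1 ∷ 5 ∷ -7 ∷ []) ∷
    []

-- Sizes and uniqueness for the two polytopes

module Increasing (k : ℤ) .{{_ : ℤ.Positive k}} .{{_ : ℤ.NonNegative k}} where

  cancel : ∀ {a b} → k ℤ.* + a ℤ.≤ k ℤ.* + b → a ℕ.≤ b
  cancel {a} {b} ka≤kb = ℤ.drop‿+≤+ (ℤ.*-cancelˡ-≤-pos (+ a) (+ b) k ka≤kb)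

  mono : ∀ {a b} → a ℕ.≤ b → k ℤ.* + a ℤ.≤ k ℤ.* + b
  mono a≤b = ℤ.*-monoˡ-≤-nonNeg k (ℤ.+≤+ a≤b)

module Decreasing (k : ℤ) .{{_ : ℤ.Negative k}} .{{_ : ℤ.NonPositive k}} where

  cancel : ∀ {a b} → k ℤ.* + a ℤ.≤ k ℤ.* + b → a ℕ.≥ b
  cancel {a} {b} ka≤kb = ℤ.drop‿+≤+ (ℤ.*-cancelˡ-≤-neg k (+ a) (+ b) ka≤kb)

  mono : ∀ {a b} → a ℕ.≥ b → k ℤ.* + a ℤ.≤ k ℤ.* + b
  mono a≥b = ℤ.*-monoˡ-≤-nonPos k (ℤ.+≤+ a≥b)

module Part₁ where
  open Polytope₁
  open Check points₁

  -- The edges s n and e w cross at (1/2, 1/2, 0).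
  crossing : Homogeneous
  crossing = + 2 ∷ + 1 ∷ + 1 ∷ + 0 ∷ []

  -- `T₁` has the edge `s n` and `T₂` the edge `e w`; at the crossing, `s` has a positive coordinate
  -- in `T₁` and is not a vertex of `T₂`.
  T₁ T₂ : Subset 8
  T₁ = tetra s n v₁ v₂
  T₂ = tetra e w n u₂

  -- Opaque, so that assembling the theorems never unfolds the computed proofs.
  abstract
    inConvexPosition : InConvexPosition
    inConvexPosition = from-yes inConvexPosition?

    -- The polytope lies in the box [-1,2] × [0,1] × [-1,1]. Of its 24 lattice points, facet
    -- inequalities exclude the 16 that are not vertices.
    emptyLattice : EmptyLattice (ℤ.- (+ 1) ∷ + 0 ∷ ℤ.- (+ 1) ∷ []) (3 ∷ 1 ∷ 2 ∷ [])
    emptyLattice = from-yes (emptyLattice? (ℤ.- (+ 1) ∷ + 0 ∷ ℤ.- (+ 1) ∷ []) (3 ∷ 1 ∷ 2 ∷ []))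

    largest-dissects : Dissects largest largest-cover
    largest-dissects = from-yes (dissects? largest largest-cover)

    largest-unimodular : All (IsUnimodular points₁) largest
    largest-unimodular = from-yes (All.all? (isUnimodular? points₁) largest)

    largest-weighs : Weighing.Weighs points₁ coordinates largest-unit largest-samples dependences largest
    largest-weighs = from-yes (Weighing.weighs? points₁ coordinates largest-unit largest-samples dependences largest)

    triangulation₁-dissects : Dissects triangulation₁ triangulation₁-cover
    triangulation₁-dissects = from-yes (dissects? triangulation₁ triangulation₁-cover)

    triangulation₂-dissects : Dissects triangulation₂ triangulation₂-cover
    triangulation₂-dissects = from-yes (dissects? triangulation₂ triangulation₂-cover)

    triangulation₁-triangulates : Triangulates triangulation₁
    triangulation₁-triangulates = from-yes (triangulates? triangulation₁)

    triangulation₂-triangulates : Triangulates triangulation₂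
    triangulation₂-triangulates = from-yes (triangulates? triangulation₂)

    triangulations-differ : Any (_∉ₗ triangulation₂) triangulation₁
    triangulations-differ = from-yes (different? triangulation₁ triangulation₂)

    T₁∈largest : T₁ ∈ₗ largest
    T₁∈largest = from-yes (T₁ ∈ₗ? largest)

    T₂∈largest : T₂ ∈ₗ largest
    T₂∈largest = from-yes (T₂ ∈ₗ? largest)

    T₁-crosses-T₂ : Crosses (coordinates T₁) (coordinates T₂) T₁ T₂ crossing
    T₁-crosses-T₂ = from-yes (crosses? (coordinates T₁) (coordinates T₂) T₁ T₂ crossing)

  module _ {c ℓ₁ ℓ₂} (K : OrderedField c ℓ₁ ℓ₂) where
    open Geometry K
    open Soundness points₁ K
    open Increasing largest-unit
    open Extremal points₁ K ℕ.≤-antisym {largest-unit} cancel mono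

    next : ∀ {a} → a ℕ.≤ 12 → ¬ (12 ℕ.≤ a) → a ℕ.≤ 11
    next _ 12≰a = ℕ.s≤s⁻¹ (ℕ.≰⇒> 12≰a)

    isTriangulation₁ : IsTriangulation V triangulation₁
    isTriangulation₁ = triangulates⇒isTriangulation {triangulation₁}
      (dissects⇒isDissection {triangulation₁} {triangulation₁-cover} triangulation₁-dissects) triangulation₁-triangulates

    isTriangulation₂ : IsTriangulation V triangulation₂
    isTriangulation₂ = triangulates⇒isTriangulation {triangulation₂}
      (dissects⇒isDissection {triangulation₂} {triangulation₂-cover} triangulation₂-dissects) triangulation₂-triangulates

    theLargest : TheUnique (Maximal (IsDissection V)) largest
    theLargest = theExtremeDissection {largest-samples} {dependences} {largest} {largest-cover} largest-dissects largest-weighs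

    largest-triangulation : ∀ {D} → IsTriangulation V D → length D ≡ 11 → Maximal (IsTriangulation V) D
    largest-triangulation {D} = extremeTriangulation {largest-samples} {dependences} {largest} {largest-cover}
      largest-dissects largest-weighs {T₁} {T₂} {crossing} T₁∈largest T₂∈largest T₁-crosses-T₂ {11} next {D}

    largest-triangulation-size : ∀ D → Maximal (IsTriangulation V) D → length D ≡ 11
    largest-triangulation-size = extremeTriangulation-size {largest-samples} {dependences} {largest} {largest-cover}
      largest-dissects largest-weighs {T₁} {T₂} {crossing} T₁∈largest T₂∈largest T₁-crosses-T₂ {11} next
      {triangulation₁} isTriangulation₁ ≡.refl

    part₁ :
      AreTheVertices V ×
      (∀ z → polytope V (embed z) ⇔ ∃ λ i → z ≡ lookup points₁ i) ×
      (∃ λ D → TheUnique (Maximal (IsDissection V)) D × length D ≡ 12 × All (IsUnimodular points₁) D) ×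
      Several (Maximal (IsTriangulation V)) ×
      (∀ D → Maximal (IsTriangulation V) D → length D ≡ 11)
    part₁ =
      inConvexPosition⇒areTheVertices inConvexPosition ,
      emptyLattice-sound (ℤ.- (+ 1) ∷ + 0 ∷ ℤ.- (+ 1) ∷ []) (3 ∷ 1 ∷ 2 ∷ []) emptyLattice ,
      (largest , theLargest , ≡.refl , largest-unimodular) ,
      (triangulation₁ , triangulation₂ , largest-triangulation isTriangulation₁ ≡.refl ,
        largest-triangulation isTriangulation₂ ≡.refl , different triangulations-differ) ,
      largest-triangulation-size

module Part₂ where
  open Polytope₂
  open Check points₂

  -- The segments s n and w e cross at (0, 1/2, 0).
  crossing : Homogeneous
  crossing = + 2 ∷ + 0 ∷ + 1 ∷ + 0 ∷ []

  -- The pair `T₁`, `T₂` is taken from `largest`, the pair `T₃`, `T₄` from `smallest`; in each pair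
  -- one tetrahedron has the edge `s n` and the other the edge `w e`.
  T₁ T₂ T₃ T₄ : Subset 8
  T₁ = tetra v₁ s v₂ n
  T₂ = tetra u₁ w s e
  T₃ = tetra w v₁ v₂ e
  T₄ = tetra u₁ w s n

  abstract
    inConvexPosition : InConvexPosition
    inConvexPosition = from-yes inConvexPosition?

    largest-dissects : Dissects largest largest-cover
    largest-dissects = from-yes (dissects? largest largest-cover)

    largest-weighs : Weighing.Weighs points₂ coordinates largest-unit largest-samples dependences largest
    largest-weighs = from-yes (Weighing.weighs? points₂ coordinates largest-unit largest-samples dependences largest)

    smallest-dissects : Dissects smallest smallest-cover
    smallest-dissects = from-yes (dissects? smallest smallest-cover)

    smallest-weighs : Weighing.Weighs points₂ coordinates smallest-unit smallest-samples dependences smallest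
    smallest-weighs = from-yes (Weighing.weighs? points₂ coordinates smallest-unit smallest-samples dependences smallest)

    largeTriangulation₁-dissects : Dissects largeTriangulation₁ largeTriangulation₁-cover
    largeTriangulation₁-dissects = from-yes (dissects? largeTriangulation₁ largeTriangulation₁-cover)

    largeTriangulation₁-triangulates : Triangulates largeTriangulation₁
    largeTriangulation₁-triangulates = from-yes (triangulates? largeTriangulation₁)

    largeTriangulation₂-dissects : Dissects largeTriangulation₂ largeTriangulation₂-cover
    largeTriangulation₂-dissects = from-yes (dissects? largeTriangulation₂ largeTriangulation₂-cover)

    largeTriangulation₂-triangulates : Triangulates largeTriangulation₂
    largeTriangulation₂-triangulates = from-yes (triangulates? largeTriangulation₂)

    largeTriangulations-differ : Any (_∉ₗ largeTriangulation₂) largeTriangulation₁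
    largeTriangulations-differ = from-yes (different? largeTriangulation₁ largeTriangulation₂)

    smallTriangulation₁-dissects : Dissects smallTriangulation₁ smallTriangulation₁-cover
    smallTriangulation₁-dissects = from-yes (dissects? smallTriangulation₁ smallTriangulation₁-cover)

    smallTriangulation₁-triangulates : Triangulates smallTriangulation₁
    smallTriangulation₁-triangulates = from-yes (triangulates? smallTriangulation₁)

    smallTriangulation₂-dissects : Dissects smallTriangulation₂ smallTriangulation₂-cover
    smallTriangulation₂-dissects = from-yes (dissects? smallTriangulation₂ smallTriangulation₂-cover)

    smallTriangulation₂-triangulates : Triangulates smallTriangulation₂
    smallTriangulation₂-triangulates = from-yes (triangulates? smallTriangulation₂)

    smallTriangulations-differ : Any (_∉ₗ smallTriangulation₂) smallTriangulation₁
    smallTriangulations-differ = from-yes (different? smallTriangulation₁ smallTriangulation₂)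

    T₁∈largest : T₁ ∈ₗ largest
    T₁∈largest = from-yes (T₁ ∈ₗ? largest)

    T₂∈largest : T₂ ∈ₗ largest
    T₂∈largest = from-yes (T₂ ∈ₗ? largest)

    T₁-crosses-T₂ : Crosses (coordinates T₁) (coordinates T₂) T₁ T₂ crossing
    T₁-crosses-T₂ = from-yes (crosses? (coordinates T₁) (coordinates T₂) T₁ T₂ crossing)

    T₃∈smallest : T₃ ∈ₗ smallest
    T₃∈smallest = from-yes (T₃ ∈ₗ? smallest)

    T₄∈smallest : T₄ ∈ₗ smallest
    T₄∈smallest = from-yes (T₄ ∈ₗ? smallest)

    T₃-crosses-T₄ : Crosses (coordinates T₃) (coordinates T₄) T₃ T₄ crossing
    T₃-crosses-T₄ = from-yes (crosses? (coordinates T₃) (coordinates T₄) T₃ T₄ crossing)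

  module _ {c ℓ₁ ℓ₂} (K : OrderedField c ℓ₁ ℓ₂) where
    open Geometry K
    open Soundness points₂ K

    ≥-antisym : ∀ {a b} → a ℕ.≥ b → b ℕ.≥ a → a ≡ b
    ≥-antisym a≥b b≥a = ℕ.≤-antisym b≥a a≥b

    module Up = Increasing largest-unit
    module Down = Decreasing smallest-unit
    module Large = Extremal points₂ K ℕ.≤-antisym {largest-unit} Up.cancel Up.mono
    module Small = Extremal points₂ K ≥-antisym {smallest-unit} Down.cancel Down.mono

    larger : ∀ {a} → a ℕ.≤ 10 → ¬ (10 ℕ.≤ a) → a ℕ.≤ 9
    larger _ 10≰a = ℕ.s≤s⁻¹ (ℕ.≰⇒> 10≰a)

    smaller : ∀ {a} → a ℕ.≥ 6 → ¬ (6 ℕ.≥ a) → a ℕ.≥ 7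
    smaller _ a≰6 = ℕ.≰⇒> a≰6

    largeTriangulation₁-isTriangulation : IsTriangulation V largeTriangulation₁
    largeTriangulation₁-isTriangulation = triangulates⇒isTriangulation {largeTriangulation₁}
      (dissects⇒isDissection {largeTriangulation₁} {largeTriangulation₁-cover} largeTriangulation₁-dissects) largeTriangulation₁-triangulates

    largeTriangulation₂-isTriangulation : IsTriangulation V largeTriangulation₂
    largeTriangulation₂-isTriangulation = triangulates⇒isTriangulation {largeTriangulation₂}
      (dissects⇒isDissection {largeTriangulation₂} {largeTriangulation₂-cover} largeTriangulation₂-dissects) largeTriangulation₂-triangulates

    smallTriangulation₁-isTriangulation : IsTriangulation V smallTriangulation₁
    smallTriangulation₁-isTriangulation = triangulates⇒isTriangulation {smallTriangulation₁}
      (dissects⇒isDissection {smallTriangulation₁} {smallTriangulation₁-cover} smallTriangulation₁-dissects) smallTriangulation₁-triangulates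

    smallTriangulation₂-isTriangulation : IsTriangulation V smallTriangulation₂
    smallTriangulation₂-isTriangulation = triangulates⇒isTriangulation {smallTriangulation₂}
      (dissects⇒isDissection {smallTriangulation₂} {smallTriangulation₂-cover} smallTriangulation₂-dissects) smallTriangulation₂-triangulates

    theLargest : TheUnique (Maximal (IsDissection V)) largest
    theLargest = Large.theExtremeDissection {largest-samples} {dependences} {largest} {largest-cover} largest-dissects largest-weighs

    largest-triangulation : ∀ {D} → IsTriangulation V D → length D ≡ 9 → Maximal (IsTriangulation V) D
    largest-triangulation {D} = Large.extremeTriangulation {largest-samples} {dependences} {largest} {largest-cover}
      largest-dissects largest-weighs {T₁} {T₂} {crossing} T₁∈largest T₂∈largest T₁-crosses-T₂ {9} larger {D}

    largest-triangulation-size : ∀ D → Maximal (IsTriangulation V) D → length D ≡ 9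
    largest-triangulation-size = Large.extremeTriangulation-size {largest-samples} {dependences} {largest} {largest-cover}
      largest-dissects largest-weighs {T₁} {T₂} {crossing} T₁∈largest T₂∈largest T₁-crosses-T₂ {9} larger
      {largeTriangulation₁} largeTriangulation₁-isTriangulation ≡.refl

    theSmallest : TheUnique (Minimal (IsDissection V)) smallest
    theSmallest = Small.theExtremeDissection {smallest-samples} {dependences} {smallest} {smallest-cover} smallest-dissects smallest-weighs

    smallest-triangulation : ∀ {D} → IsTriangulation V D → length D ≡ 7 → Minimal (IsTriangulation V) D
    smallest-triangulation {D} = Small.extremeTriangulation {smallest-samples} {dependences} {smallest} {smallest-cover}
      smallest-dissects smallest-weighs {T₃} {T₄} {crossing} T₃∈smallest T₄∈smallest T₃-crosses-T₄ {7} smaller {D}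

    smallest-triangulation-size : ∀ D → Minimal (IsTriangulation V) D → length D ≡ 7
    smallest-triangulation-size = Small.extremeTriangulation-size {smallest-samples} {dependences} {smallest} {smallest-cover}
      smallest-dissects smallest-weighs {T₃} {T₄} {crossing} T₃∈smallest T₄∈smallest T₃-crosses-T₄ {7} smaller
      {smallTriangulation₁} smallTriangulation₁-isTriangulation ≡.refl

    part₂ :
      AreTheVertices V ×
      (∃ λ D → TheUnique (Minimal (IsDissection V)) D × length D ≡ 6) ×
      Several (Minimal (IsTriangulation V)) ×
      (∀ D → Minimal (IsTriangulation V) D → length D ≡ 7) ×
      Several (Maximal (IsTriangulation V)) ×
      (∀ D → Maximal (IsTriangulation V) D → length D ≡ 9) ×
      (∃ λ D → TheUnique (Maximal (IsDissection V)) D × length D ≡ 10)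
    part₂ =
      inConvexPosition⇒areTheVertices inConvexPosition ,
      (smallest , theSmallest , ≡.refl) ,
      (smallTriangulation₁ , smallTriangulation₂ , smallest-triangulation smallTriangulation₁-isTriangulation ≡.refl ,
        smallest-triangulation smallTriangulation₂-isTriangulation ≡.refl , different smallTriangulations-differ) ,
      smallest-triangulation-size ,
      (largeTriangulation₁ , largeTriangulation₂ , largest-triangulation largeTriangulation₁-isTriangulation ≡.refl ,
        largest-triangulation largeTriangulation₂-isTriangulation ≡.refl , different largeTriangulations-differ) ,
      largest-triangulation-size ,
      (largest , theLargest , ≡.refl)

proposition2p3 : ∀ {c ℓ₁ ℓ₂} (K : OrderedField c ℓ₁ ℓ₂) →
  let open Geometry K
      V₁ = embedAll points₁
      V₂ = embedAll points₂
  in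
  ( AreTheVertices V₁ ×
    (∀ z → polytope V₁ (embed z) ⇔ ∃ λ i → z ≡ lookup points₁ i) ×
    (∃ λ D → TheUnique (Maximal (IsDissection V₁)) D ×
      length D ≡ 12 × All (IsUnimodular points₁) D) ×
    Several (Maximal (IsTriangulation V₁)) ×
    (∀ D → Maximal (IsTriangulation V₁) D → length D ≡ 11) ) ×
  ( AreTheVertices V₂ ×
    (∃ λ D → TheUnique (Minimal (IsDissection V₂)) D × length D ≡ 6) ×
    Several (Minimal (IsTriangulation V₂)) ×
    (∀ D → Minimal (IsTriangulation V₂) D → length D ≡ 7) ×
    Several (Maximal (IsTriangulation V₂)) ×
    (∀ D → Maximal (IsTriangulation V₂) D → length D ≡ 9) ×
    (∃ λ D → TheUnique (Maximal (IsDissection V₂)) D × length D ≡ 10) )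
proposition2p3 K = Part₁.part₁ K , Part₂.part₂ K
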